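{- Let $m\le 1$ and $\mathcal{S}=\{m,m+1,\ldots,1\}$. Let $n(i,\mathbf{c})$ be non-negative integers for $i\in\mathbb{Z}$ and $\mathbf{c}=(c^m,\ldots,c^1)\in\mathbb{N}^{2-m}$. Define $n_i=\sum_{\mathbf{c}}n(i,\mathbf{c})$, let $\ell,r$ be the smallest and largest $i$ with $n_i>0$, assume $n_i>0$ for $\ell\le i\le r$, and assume the compatibility condition $\chi_{i=0}+\sum_{s\in\mathcal{S},\mathbf{c}}c^s\,n(i-s,\mathbf{c})=\sum_{\mathbf{c}}n(i,\mathbf{c})$ for $\ell\le i\le r$. Assume moreover that either $m=-1$, or $n(i,\mathbf{c})=0$ for all $i<0$ and all $\mathbf{c}$. Let $n=\sum_i n_i$, $n(i,s)=\sum_{\mathbf{c}}c^s\,n(i-s,\mathbf{c})$, and $n_s(b)=\sum_i\sum_{\mathbf{c}:c^s=b}n(i,\mathbf{c})$. Then the number of $\mathcal{S}$-embedded Cayley trees in which, for all $i$ and $\mathbf{c}$, exactly $n(i,\mathbf{c})$ vertices have in-type $(i;\mathbf{c})$ is $$\frac{n!\prod_{i=\ell}^r(n_i-1)!}{\prod_{i,\mathbf{c}}n(i,\mathbf{c})!\prod_{b\ge 0,\,s\in\mathcal{S}}b!^{\,n_s(b)}}\prod_{i=\ell}^{ -1}n(i,-1)\prod_{i=1}^r n(i,1).$$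
   Context: An $\mathcal{S}$-embedded Cayley tree is a tree on vertex set $\{1,\ldots,n\}$ with a distinguished root, together with abscissas $a(v)\in\mathbb{Z}$ such that the root has abscissa $0$ and $a(v')-a(v)\in\mathcal{S}$ whenever $v'$ is a child of $v$. A vertex $v$ has in-type $(i;\mathbf{c})$, $\mathbf{c}=(c^m,\ldots,c^1)$, if $a(v)=i$ and for each $m\le k\le 1$, $v$ has exactly $c^k$ children at abscissa $i+k$. Thus $n(i,s)$ is the number of vertices at abscissa $i$ whose parent lies at abscissa $i-s$, and $n_s(b)$ is the number of vertices $v$ having exactly $b$ children at abscissa $a(v)+s$. $\chi_P$ is $1$ if $P$ holds and $0$ otherwise.
   Formalization: The compatibility condition is required for all integers i, not only ℓ ≤ i ≤ r (so ℓ ≤ 0 ≤ r and no vertex has children outside [ℓ,r]); as printed it fails for m=1, n(0,(1))=1, all else 0, where the formula gives 1 but no tree exists. -}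

module Defs where

open import Data.Nat as ℕ using (ℕ; zero; suc; _!; _^_; _∸_)
open import Data.Integer as ℤ using (ℤ; +_; -[1+_]; _-_; 0ℤ; 1ℤ; -1ℤ; ∣_∣)
open import Data.Fin using (Fin; toℕ)
open import Data.Fin.Properties using () renaming (_≟_ to _≟F_)
open import Data.Vec using (Vec; []; _∷_; lookup)
open import Data.Nat.ListAction using (sum; product)
open import Data.List using (List; []; _∷_; [_]; map; concatMap; upTo; length; filter; allFin)
open import Data.Bool using (Bool; true; false; if_then_else_; _∧_; not)
open import Data.Product using (_×_; Σ; _,_)
open import Relation.Nullary.Decidable using (⌊_⌋)
open import Relation.Binary.PropositionalEquality using (_≡_)
open import Data.List.Relation.Unary.Unique.Propositional using (Unique)
open import Data.List.Membership.Propositional using (_∈_)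

clamp : ℤ → ℕ
clamp (+ n)    = n
clamp -[1+ n ] = 0

range : ℤ → ℤ → List ℤ
range a b = map (λ j → a ℤ.+ + j) (upTo (clamp (b - a ℤ.+ 1ℤ)))

boxes : (k B : ℕ) → List (Vec ℕ k)
boxes zero    B = [ [] ]
boxes (suc k) B = concatMap (λ x → map (x ∷_) (boxes k B)) (upTo (suc B))

Σ[_∈_] : {A : Set} → (A → ℕ) → List A → ℕ
Σ[ f ∈ xs ] = sum (map f xs)

Π[_∈_] : {A : Set} → (A → ℕ) → List A → ℕ
Π[ f ∈ xs ] = product (map f xs)

iter : {A : Set} → ℕ → (A → A) → A → A
iter zero    f x = x
iter (suc k) f x = f (iter k f x)

_==ℤ_ : ℤ → ℤ → Bool
a ==ℤ b = ⌊ a ℤ.≟ b ⌋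

_==ℕ_ : ℕ → ℕ → Bool
a ==ℕ b = ⌊ a ℕ.≟ b ⌋

_==F_ : {n : ℕ} → Fin n → Fin n → Bool
a ==F b = ⌊ a ≟F b ⌋

χ : Bool → ℕ
χ true  = 1
χ false = 0

-- Step set S = {m, m+1, ..., 1}, |S| = 2 - m  (for m ≤ 1)

width : ℤ → ℕ
width m = suc ∣ 1ℤ - m ∣

sIdx : (m : ℤ) → Fin (width m) → ℤ
sIdx m j = m ℤ.+ + toℕ j

-- c^s for c = (c^m, ..., c^1); equals 0 when s ∉ S
coef : (m : ℤ) → Vec ℕ (width m) → ℤ → ℕ
coef m c s = Σ[ (λ j → if sIdx m j ==ℤ s then lookup c j else 0) ∈ allFin (width m) ]

-- Quantities attached to data n(i,c) = N i c, supported in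
-- [ℓ, r] × {0..B}^(2-m)

module Quant (m ℓ r : ℤ) (B : ℕ) (N : ℤ → Vec ℕ (width m) → ℕ) where

  Cs : List (Vec ℕ (width m))
  Cs = boxes (width m) B

  nI : ℤ → ℕ
  nI i = Σ[ N i ∈ Cs ]

  total : ℕ
  total = Σ[ nI ∈ range ℓ r ]

  nIS : ℤ → ℤ → ℕ
  nIS i s = Σ[ (λ c → coef m c s ℕ.* N (i - s) c) ∈ Cs ]

  nSB : Fin (width m) → ℕ → ℕ
  nSB j b = Σ[ (λ i → Σ[ (λ c → if lookup c j ==ℕ b then N i c else 0) ∈ Cs ]) ∈ range ℓ r ]

  numerator : ℕ
  numerator = total ! ℕ.* Π[ (λ i → (nI i ∸ 1) !) ∈ range ℓ r ]
              ℕ.* Π[ (λ i → nIS i -1ℤ) ∈ range ℓ -1ℤ ]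
              ℕ.* Π[ (λ i → nIS i 1ℤ) ∈ range 1ℤ r ]

  denominator : ℕ
  denominator = Π[ (λ i → Π[ (λ c → N i c !) ∈ Cs ]) ∈ range ℓ r ]
                ℕ.* Π[ (λ j → Π[ (λ b → (b !) ^ nSB j b) ∈ upTo (suc B) ] ) ∈ allFin (width m) ]

-- S-embedded Cayley trees on vertex set Fin n ({1..n}).
-- Data: root ρ, parent vector par (with par ρ = ρ), abscissas a.

TreeData : ℕ → Set
TreeData n = Fin n × Vec (Fin n) n × Vec ℤ n

-- (ρ, par) is a rooted tree: par ρ = ρ and every vertex reaches ρ
-- by following parents; a(ρ) = 0 and a(v) - a(par v) ∈ S for v ≠ ρ.
IsEmbeddedTree : (m : ℤ) {n : ℕ} → TreeData n → Set
IsEmbeddedTree m {n} (ρ , par , a) =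
    (lookup par ρ ≡ ρ)
  × ((v : Fin n) → iter n (lookup par) v ≡ ρ)
  × (lookup a ρ ≡ 0ℤ)
  × ((v : Fin n) → (v ≡ ρ → Data.Empty.⊥) →
        (m ℤ.≤ lookup a v - lookup a (lookup par v))
      × (lookup a v - lookup a (lookup par v) ℤ.≤ 1ℤ))
  where import Data.Empty

childrenAt : {n : ℕ} → TreeData n → Fin n → ℤ → ℕ
childrenAt {n} (ρ , par , a) v s =
  length (filter (λ u → Data.Bool.T? (not (u ==F ρ) ∧ (lookup par u ==F v)
                                      ∧ (lookup a u ==ℤ (lookup a v ℤ.+ s))))
                 (allFin n))
  where import Data.Bool

hasInType : (m : ℤ) {n : ℕ} → TreeData n → Fin n → ℤ → Vec ℕ (width m) → Bool
hasInType m {n} t@(ρ , par , a) v i c =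
  (lookup a v ==ℤ i) ∧ allJ (allFin (width m))
  where
  allJ : List (Fin (width m)) → Bool
  allJ []       = true
  allJ (j ∷ js) = (childrenAt t v (sIdx m j) ==ℕ lookup c j) ∧ allJ js

inTypeCount : (m : ℤ) {n : ℕ} → TreeData n → ℤ → Vec ℕ (width m) → ℕ
inTypeCount m {n} t i c =
  length (filter (λ v → Data.Bool.T? (hasInType m t v i c)) (allFin n))
  where import Data.Bool

HasCount : {A : Set} → (A → Set) → ℕ → Set
HasCount {A} P K =
  Σ (List A) λ L → Unique L
    × ((x : A) → (x ∈ L → P x) × (P x → x ∈ L))
    × (length L ≡ K)

{-# OPTIONS --safe #-}

-- First give every vertex its in-type: there are n! / Π n(i,c)! ways. It then remains to choose
-- parents so that each vertex v gets its prescribed number of children at every abscissa. Add the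
-- children sets one after the other, starting from n isolated vertices and keeping a forest: the
-- children of v at abscissa k are chosen among the current roots at abscissa k, except the root
-- of v's own component. Taking the abscissas in the order r, ..., 1, ℓ, ..., -1, 0, and for each
-- k first the vertices v whose component has its root at k and then the others, the number of
-- available roots does not depend on the previous choices. The steps being at most 1 (and at least
-- -1 if there are negative abscissas), the second class consists of vertices at the neighbour k∓1
-- of k, and for k ≠ 0 the factors multiply to (n_k - 1)! n(k,±1) / Π c!; for k = 0 only the first
-- class occurs and they multiply to (n_0 - 1)! / Π c!.

module Submission where

open import Defs
open import Data.Nat using (ℕ; _*_; _+_; _<_)
open import Data.Integer using (ℤ; _≤_; 0ℤ; 1ℤ; -1ℤ) renaming (_<_ to _<ℤ_)
open import Data.Vec using (Vec)
open import Data.Vec.Relation.Unary.All using (All)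
open import Data.Fin using (Fin)
open import Data.List using (allFin)
open import Data.Product using (Σ; _×_)
open import Data.Sum using (_⊎_)
open import Relation.Binary.PropositionalEquality using (_≡_; _≢_)

open import Algebra.Structures using (IsCommutativeMonoid)
open import Algebra.Properties.CommutativeSemigroup using (interchange)
open import Data.Bool using (Bool; true; false; if_then_else_; not; T; T?; _∧_)
open import Data.Bool.ListAction using (all)
open import Data.Empty using (⊥; ⊥-elim)
open import Data.Fin using (zero; suc; toℕ; fromℕ<)
import Data.Fin.Properties as Fin
import Data.Integer as ℤ
import Data.Integer.Properties as ℤ
import Data.Integer.Tactic.RingSolver as ℤ-Ring
open import Algebra.Properties.AbelianGroup ℤ.+-0-abelianGroup using (∙-cancelˡ)
open import Data.List using (List; []; _∷_; [_]; _++_; map; filter; foldr; length; upTo; concatMap; cartesianProduct)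
import Data.List as List
open import Data.List.Properties using (map-tabulate; map-∘; length-map; length-++; ++-identityʳ)
open import Data.List.Membership.Propositional using (_∈_; _∉_; find; lose)
open import Data.List.Membership.Propositional.Properties
open import Data.List.Relation.Unary.All as ListAll using ([]; _∷_)
open import Data.List.Relation.Unary.AllPairs using ([]; _∷_)
open import Data.List.Relation.Unary.Any using (here; there)
open import Data.List.Relation.Unary.Unique.Propositional using (Unique)
import Data.List.Relation.Unary.Unique.Propositional.Properties as Unique
open import Data.Nat using (zero; suc; _∸_; _^_; _!; z≤n; s≤s; s≤s⁻¹; z<s)
import Data.Nat as ℕ
open import Data.Nat.Combinatorics.Base using (_P′_)
open import Data.Nat.Properties hiding (_≟_)
open import Algebra.Properties.CommutativeSemigroup *-commutativeSemigroup using (x∙yz≈y∙xz)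
open import Algebra.Properties.CommutativeSemigroup +-commutativeSemigroup using (xy∙z≈xz∙y)
open import Data.Nat.Tactic.RingSolver using (solve-∀)
open import Data.Product using (_,_; proj₁; proj₂; ∃; uncurry)
import Data.Product.Properties as Product
open import Data.Sum using (inj₁; inj₂; [_,_]′)
open import Data.Vec using ([]; _∷_; lookup; tabulate)
import Data.Vec as Vec
import Data.Vec.Properties as Vec
open import Data.Vec.Properties using (lookup∘tabulate)
open import Data.Vec.Relation.Unary.All using ([]; _∷_)
import Data.Vec.Relation.Unary.All.Properties as VecAll
open import Function using (_∘_; id)
open import Relation.Binary.Definitions using (DecidableEquality)
open import Relation.Binary.PropositionalEquality using (refl; sym; trans; cong; cong₂; subst; subst₂)
open import Relation.Binary.PropositionalEquality using (module ≡-Reasoning)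
open import Relation.Nullary using (Dec; yes; no; ¬_; ¬?; _×-dec_)
open import Relation.Nullary.Decidable using (⌊_⌋)
open ≡-Reasoning

private variable
  A C : Set

bool : ∀ b → b ≡ true ⊎ b ≡ false
bool true  = inj₁ refl
bool false = inj₂ refl

true≢false : ∀ {b} → b ≡ true → b ≡ false → ⊥
true≢false refl ()

⌊⌋-true : {P : Set} (d : Dec P) → P → ⌊ d ⌋ ≡ true
⌊⌋-true (yes _) p = refl
⌊⌋-true (no ¬p) p = ⊥-elim (¬p p)

⌊⌋-false : {P : Set} (d : Dec P) → ¬ P → ⌊ d ⌋ ≡ false
⌊⌋-false (yes p) ¬p = ⊥-elim (¬p p)
⌊⌋-false (no _)  ¬p = refl

⌊⌋-true⁻¹ : {P : Set} (d : Dec P) → ⌊ d ⌋ ≡ true → P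
⌊⌋-true⁻¹ (yes p) _ = p

⌊⌋-false⁻¹ : {P : Set} (d : Dec P) → ⌊ d ⌋ ≡ false → ¬ P
⌊⌋-false⁻¹ (no ¬p) _ = ¬p

⌊⌋-cong : {P Q : Set} (d : Dec P) (e : Dec Q) → (P → Q) → (Q → P) → ⌊ d ⌋ ≡ ⌊ e ⌋
⌊⌋-cong (yes p) e f g = sym (⌊⌋-true e (f p))
⌊⌋-cong (no ¬p) e f g = sym (⌊⌋-false e (¬p ∘ g))

if-yes : {X : Set} (_≟_ : DecidableEquality A) {x y : A} {p q : X} → x ≡ y → (if ⌊ x ≟ y ⌋ then p else q) ≡ p
if-yes _≟_ {x} {y} {p} {q} e = cong (if_then p else q) (⌊⌋-true (x ≟ y) e)

if-no : {X : Set} (_≟_ : DecidableEquality A) {x y : A} {p q : X} → x ≢ y → (if ⌊ x ≟ y ⌋ then p else q) ≡ q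
if-no _≟_ {x} {y} {p} {q} ne = cong (if_then p else q) (⌊⌋-false (x ≟ y) ne)

-- Sums and products over lists

module BigOp (_∙_ : ℕ → ℕ → ℕ) (ε : ℕ) (isCM : IsCommutativeMonoid _≡_ _∙_ ε) where

  open IsCommutativeMonoid isCM using (assoc; identityˡ; identityʳ; isCommutativeSemigroup)

  big : (A → ℕ) → List A → ℕ
  big f xs = foldr _∙_ ε (map f xs)

  big-cong-∈ : {f g : A → ℕ} (xs : List A) → (∀ x → x ∈ xs → f x ≡ g x) → big f xs ≡ big g xs
  big-cong-∈ []       f≡g = refl
  big-cong-∈ (x ∷ xs) f≡g = cong₂ _∙_ (f≡g x (here refl)) (big-cong-∈ xs λ y → f≡g y ∘ there)

  big-cong : {f g : A → ℕ} (xs : List A) → (∀ x → f x ≡ g x) → big f xs ≡ big g xs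
  big-cong xs f≡g = big-cong-∈ xs λ x _ → f≡g x

  big-ε : {f : A → ℕ} (xs : List A) → (∀ x → x ∈ xs → f x ≡ ε) → big f xs ≡ ε
  big-ε []       f≡ε = refl
  big-ε (x ∷ xs) f≡ε =
    trans (cong₂ _∙_ (f≡ε x (here refl)) (big-ε xs λ y → f≡ε y ∘ there)) (identityˡ ε)

  big-∙ : (f g : A → ℕ) (xs : List A) → big (λ x → f x ∙ g x) xs ≡ big f xs ∙ big g xs
  big-∙ f g []       = sym (identityˡ ε)
  big-∙ f g (x ∷ xs) = trans (cong ((f x ∙ g x) ∙_) (big-∙ f g xs))
    (interchange (record { isCommutativeSemigroup = isCommutativeSemigroup }) (f x) (g x) (big f xs) (big g xs))

  big-swap : (f : A → C → ℕ) (xs : List A) (ys : List C) →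
    big (λ x → big (f x) ys) xs ≡ big (λ y → big (λ x → f x y) xs) ys
  big-swap f []       ys = sym (big-ε ys λ _ _ → refl)
  big-swap f (x ∷ xs) ys = trans (cong (big (f x) ys ∙_) (big-swap f xs ys)) (sym (big-∙ (f x) _ ys))

  big-++ : (f : A → ℕ) (xs ys : List A) → big f (xs ++ ys) ≡ big f xs ∙ big f ys
  big-++ f []       ys = sym (identityˡ _)
  big-++ f (x ∷ xs) ys = trans (cong (f x ∙_) (big-++ f xs ys)) (sym (assoc _ _ _))

  big-map : (f : C → ℕ) (g : A → C) (xs : List A) → big f (map g xs) ≡ big (f ∘ g) xs
  big-map f g xs = cong (foldr _∙_ ε) (sym (map-∘ xs))

  big-cartesianProduct : (f : A × C → ℕ) (xs : List A) (ys : List C) →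
    big f (cartesianProduct xs ys) ≡ big (λ x → big (λ y → f (x , y)) ys) xs
  big-cartesianProduct f []       ys = refl
  big-cartesianProduct f (x ∷ xs) ys = trans (big-++ f (map (x ,_) ys) _)
    (cong₂ _∙_ (big-map f (x ,_) ys) (big-cartesianProduct f xs ys))

  big-allFin-suc : ∀ {n} (f : Fin (suc n) → ℕ) → big f (allFin (suc n)) ≡ f zero ∙ big (f ∘ suc) (allFin n)
  big-allFin-suc {n} f = cong (λ xs → f zero ∙ foldr _∙_ ε xs)
    (trans (map-tabulate suc f) (sym (map-tabulate (λ i → i) (f ∘ suc))))

  big-filter : (p : A → Bool) (f : A → ℕ) (xs : List A) →
    big f (filter (λ x → T? (p x)) xs) ≡ big (λ x → if p x then f x else ε) xs
  big-filter p f []       = refl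
  big-filter p f (x ∷ xs) with p x
  ... | true  = cong (f x ∙_) (big-filter p f xs)
  ... | false = trans (big-filter p f xs) (sym (identityˡ _))

  big-split : (p : A → Bool) (f : A → ℕ) (xs : List A) →
    big (λ x → if p x then ε else f x) xs ∙ big (λ x → if p x then f x else ε) xs ≡ big f xs
  big-split p f xs = trans (sym (big-∙ _ _ xs)) (big-cong xs pointwise)
    where
    pointwise : ∀ x → ((if p x then ε else f x) ∙ (if p x then f x else ε)) ≡ f x
    pointwise x with p x
    ... | true  = identityˡ _
    ... | false = identityʳ _

  big-single : {f : A → ℕ} {xs : List A} → Unique xs → ∀ {y} → y ∈ xs →
    (∀ x → x ∈ xs → x ≢ y → f x ≡ ε) → big f xs ≡ f y
  big-single {xs = x ∷ xs} (x∉ ∷ _) (here refl) f≡ε = trans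
    (cong (_ ∙_) (big-ε xs λ z z∈ → f≡ε z (there z∈) (λ z≡x → ListAll.lookup x∉ z∈ (sym z≡x))))
    (identityʳ _)
  big-single {xs = x ∷ xs} (x∉ ∷ uxs) (there y∈) f≡ε = trans
    (cong₂ _∙_ (f≡ε x (here refl) (ListAll.lookup x∉ y∈)) (big-single uxs y∈ λ z → f≡ε z ∘ there))
    (identityˡ _)

  module _ (_≟_ : DecidableEquality C) where

    big-by-key : (key : A → C) (f : A → ℕ) (xs : List A) (ks : List C) → Unique ks →
      (∀ x → x ∈ xs → key x ∈ ks ⊎ f x ≡ ε) →
      big (λ k → big (λ x → if ⌊ key x ≟ k ⌋ then f x else ε) xs) ks ≡ big f xs
    big-by-key key f xs ks uks key∈ =
      trans (sym (big-swap (λ x k → if ⌊ key x ≟ k ⌋ then f x else ε) xs ks)) (big-cong-∈ xs inner)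
      where
      inner : ∀ x → x ∈ xs → big (λ k → if ⌊ key x ≟ k ⌋ then f x else ε) ks ≡ f x
      inner x x∈ with key∈ x x∈
      ... | inj₁ k∈ = trans (big-single uks k∈ λ k _ k≢ → if-no _≟_ (k≢ ∘ sym)) (if-yes _≟_ refl)
      ... | inj₂ e  = trans (big-ε ks λ k _ → if-same k) (sym e)
        where
        if-same : ∀ k → (if ⌊ key x ≟ k ⌋ then f x else ε) ≡ ε
        if-same k with ⌊ key x ≟ k ⌋
        ... | true  = e
        ... | false = refl

    big-same-support : (f : C → ℕ) (xs ys : List C) → Unique xs → Unique ys →
      (∀ x → x ∈ xs → x ∈ ys ⊎ f x ≡ ε) → (∀ y → y ∈ ys → y ∈ xs ⊎ f y ≡ ε) → big f xs ≡ big f ys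
    big-same-support f xs ys uxs uys xs⊆ys ys⊆xs = begin
      big f xs
        ≡⟨ sym (big-by-key (λ x → x) f xs ys uys xs⊆ys) ⟩
      big (λ y → big (λ x → if ⌊ x ≟ y ⌋ then f x else ε) xs) ys
        ≡⟨ big-swap (λ y x → if ⌊ x ≟ y ⌋ then f x else ε) ys xs ⟩
      big (λ x → big (λ y → if ⌊ x ≟ y ⌋ then f x else ε) ys) xs
        ≡⟨ big-cong xs (λ x → big-cong ys (flip x)) ⟩
      big (λ x → big (λ y → if ⌊ y ≟ x ⌋ then f y else ε) ys) xs
        ≡⟨ big-by-key (λ y → y) f ys xs uxs ys⊆xs ⟩
      big f ys ∎
      where
      flip : ∀ x y → (if ⌊ x ≟ y ⌋ then f x else ε) ≡ (if ⌊ y ≟ x ⌋ then f y else ε)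
      flip x y with x ≟ y
      ... | yes refl = sym (if-yes _≟_ refl)
      ... | no x≢y   = sym (if-no _≟_ (x≢y ∘ sym))

module Sum = BigOp _+_ 0 +-0-isCommutativeMonoid
module Prod = BigOp _*_ 1 *-1-isCommutativeMonoid

Σ-*ˡ : (k : ℕ) (f : A → ℕ) (xs : List A) → Σ[ (λ x → k * f x) ∈ xs ] ≡ k * Σ[ f ∈ xs ]
Σ-*ˡ k f []       = sym (*-zeroʳ k)
Σ-*ˡ k f (x ∷ xs) = trans (cong (k * f x +_) (Σ-*ˡ k f xs)) (sym (*-distribˡ-+ k (f x) _))

Σ-0⇒0 : {f : A → ℕ} (xs : List A) → Σ[ f ∈ xs ] ≡ 0 → ∀ {x} → x ∈ xs → f x ≡ 0
Σ-0⇒0 {f = f} (x ∷ xs) e (here refl) = m+n≡0⇒m≡0 (f x) e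
Σ-0⇒0 {f = f} (x ∷ xs) e (there x∈)  = Σ-0⇒0 xs (m+n≡0⇒n≡0 (f x) e) x∈

Π-if-^ : (p : A → Bool) (b : ℕ) (xs : List A) →
  Π[ (λ x → if p x then b else 1) ∈ xs ] ≡ b ^ Σ[ (λ x → χ (p x)) ∈ xs ]
Π-if-^ p b []       = refl
Π-if-^ p b (x ∷ xs) with p x
... | true  = cong (b *_) (Π-if-^ p b xs)
... | false = trans (*-identityˡ _) (Π-if-^ p b xs)

length-filter-χ : (p : A → Bool) (xs : List A) →
  length (filter (λ x → T? (p x)) xs) ≡ Σ[ (λ x → χ (p x)) ∈ xs ]
length-filter-χ p []       = refl
length-filter-χ p (x ∷ xs) with p x
... | true  = cong suc (length-filter-χ p xs)
... | false = length-filter-χ p xs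

-- Counting

HasRatio : (A → Set) → ℕ → ℕ → Set
HasRatio P D M = Σ ℕ λ K → HasCount P K × K * D ≡ M

HasRatio-≡ : {P : A → Set} {D D′ M M′ : ℕ} → D ≡ D′ → M ≡ M′ → HasRatio P D M → HasRatio P D′ M′
HasRatio-≡ refl refl R = R

HasCount-bijection : {P : A → Set} {Q : C → Set} {K : ℕ} (g : A → C) →
  (∀ x → P x → Q (g x)) →
  (∀ x y → P x → P y → g x ≡ g y → x ≡ y) →
  (∀ y → Q y → Σ A λ x → P x × g x ≡ y) →
  HasCount P K → HasCount Q K
HasCount-bijection {P = P} {Q} g into inj onto (L , uL , L↔ , len) =
  map g L , unique L uL (λ x x∈ → proj₁ (L↔ x) x∈) ,
  (λ y → (λ y∈ → let (x , x∈ , e) = ∈-map⁻ g y∈ in subst Q (sym e) (into x (proj₁ (L↔ x) x∈))) ,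
         (λ qy → let (x , px , e) = onto y qy in subst (_∈ map g L) e (∈-map⁺ g (proj₂ (L↔ x) px)))) ,
  trans (length-map g L) len
  where
  unique : ∀ xs → Unique xs → (∀ x → x ∈ xs → P x) → Unique (map g xs)
  unique []       _          _  = []
  unique (x ∷ xs) (x∉ ∷ uxs) ps = ListAll.tabulate fresh ∷ unique xs uxs (λ y → ps y ∘ there)
    where
    fresh : ∀ {z} → z ∈ map g xs → g x ≢ z
    fresh z∈ gx≡z with ∈-map⁻ g z∈
    ... | (y , y∈ , e) = ListAll.lookup x∉ y∈ (inj x y (ps x (here refl)) (ps y (there y∈)) (trans gx≡z e))

HasRatio-bijection : {P : A → Set} {Q : C → Set} {D M : ℕ} (g : A → C) →
  (∀ x → P x → Q (g x)) →
  (∀ x y → P x → P y → g x ≡ g y → x ≡ y) →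
  (∀ y → Q y → Σ A λ x → P x × g x ≡ y) →
  HasRatio P D M → HasRatio Q D M
HasRatio-bijection g into inj onto (K , hc , e) = K , HasCount-bijection g into inj onto hc , e

HasRatio-Σ-list : {Q : A → C → Set} (D : ℕ) (M : A → ℕ) (xs : List A) → Unique xs →
  (∀ x → x ∈ xs → HasRatio (Q x) D (M x)) →
  HasRatio (λ ((x , y) : A × C) → x ∈ xs × Q x y) D Σ[ M ∈ xs ]
HasRatio-Σ-list D M [] _ _ = 0 , ([] , [] , (λ _ → (λ ()) , λ ()) , refl) , refl
HasRatio-Σ-list {A} {C} {Q} D M (x ∷ xs) (x∉ ∷ uxs) R
  with R x (here refl) | HasRatio-Σ-list D M xs uxs (λ y → R y ∘ there)
... | K , (L , uL , L↔ , len) , e | K′ , (L′ , uL′ , L′↔ , len′) , e′ =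
  K + K′ ,
  (map (x ,_) L ++ L′ ,
   Unique.++⁺ (Unique.map⁺ (cong proj₂) uL) uL′ disjoint ,
   (λ (y , z) → to y z , from y z) ,
   trans (length-++ (map (x ,_) L)) (cong₂ _+_ (trans (length-map _ L) len) len′)) ,
  trans (*-distribʳ-+ D K K′) (cong₂ _+_ e e′)
  where
  disjoint : ∀ {p} → ¬ (p ∈ map (x ,_) L × p ∈ L′)
  disjoint {p} (p∈ , p∈′) with ∈-map⁻ (x ,_) p∈
  ... | (_ , _ , refl) = ListAll.lookup x∉ (proj₁ (proj₁ (L′↔ p) p∈′)) refl
  to : ∀ y z → (y , z) ∈ map (x ,_) L ++ L′ → y ∈ x ∷ xs × Q y z
  to y z p∈ with ∈-++⁻ (map (x ,_) L) p∈
  ... | inj₁ p∈₁ with ∈-map⁻ (x ,_) p∈₁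
  ...   | (_ , z∈ , refl) = here refl , proj₁ (L↔ z) z∈
  to y z p∈ | inj₂ p∈₂ = there (proj₁ (proj₁ (L′↔ _) p∈₂)) , proj₂ (proj₁ (L′↔ _) p∈₂)
  from : ∀ y z → y ∈ x ∷ xs × Q y z → (y , z) ∈ map (x ,_) L ++ L′
  from y z (here refl , q) = ∈-++⁺ˡ (∈-map⁺ (x ,_) (proj₂ (L↔ z) q))
  from y z (there y∈ , q)  = ∈-++⁺ʳ (map (x ,_) L) (proj₂ (L′↔ _) (y∈ , q))

HasRatio-Σ : {P : A → Set} {Q : A → C → Set} {D₁ M₁ D₂ M₂ : ℕ} →
  HasRatio P D₁ M₁ → (∀ x → P x → HasRatio (Q x) D₂ M₂) →
  HasRatio (λ ((x , y) : A × C) → P x × Q x y) (D₁ * D₂) (M₁ * M₂)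
HasRatio-Σ {D₁ = D₁} {M₁} {D₂} {M₂} (K , (L , uL , L↔ , len) , e) R
  with HasRatio-Σ-list D₂ (λ _ → M₂) L uL (λ x x∈ → R x (proj₁ (L↔ x) x∈))
... | K′ , hc , e′ =
  K′ ,
  HasCount-bijection (λ p → p) (λ (x , y) (x∈ , q) → proj₁ (L↔ x) x∈ , q) (λ _ _ _ _ p → p)
    (λ (x , y) (px , q) → (x , y) , (proj₂ (L↔ x) px , q) , refl) hc ,
  (begin
    K′ * (D₁ * D₂)     ≡⟨ x∙yz≈y∙xz K′ D₁ D₂ ⟩
    D₁ * (K′ * D₂)     ≡⟨ cong (D₁ *_) (trans e′ (const L)) ⟩
    D₁ * (length L * M₂) ≡⟨ cong (λ l → D₁ * (l * M₂)) len ⟩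
    D₁ * (K * M₂)      ≡⟨ x∙yz≈y∙xz D₁ K M₂ ⟩
    K * (D₁ * M₂)      ≡⟨ sym (*-assoc K D₁ M₂) ⟩
    (K * D₁) * M₂      ≡⟨ cong (_* M₂) e ⟩
    M₁ * M₂            ∎)
  where
  const : ∀ xs → Σ[ (λ _ → M₂) ∈ xs ] ≡ length xs * M₂
  const []       = refl
  const (_ ∷ xs) = cong (M₂ +_) (const xs)

-- Words with prescribed letter counts

module Words {T : Set} (_≟_ : DecidableEquality T) (ts : List T) (uts : Unique ts) where

  occurrences : ∀ {n} → Vec T n → T → ℕ
  occurrences {n} w t = Σ[ (λ v → χ ⌊ lookup w v ≟ t ⌋) ∈ allFin n ]

  HasContent : ∀ {n} → (T → ℕ) → Vec T n → Set
  HasContent N w = ∀ t → occurrences w t ≡ N t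

  occurrences-∷ : ∀ {n} x (w : Vec T n) t → occurrences (x ∷ w) t ≡ χ ⌊ x ≟ t ⌋ + occurrences w t
  occurrences-∷ x w t = Sum.big-allFin-suc (λ v → χ ⌊ lookup (x ∷ w) v ≟ t ⌋)

  χ-yes : ∀ {x y} → x ≡ y → χ ⌊ x ≟ y ⌋ ≡ 1
  χ-yes {x} {y} e = cong χ (⌊⌋-true (x ≟ y) e)

  χ-no : ∀ {x y} → x ≢ y → χ ⌊ x ≟ y ⌋ ≡ 0
  χ-no {x} {y} ne = cong χ (⌊⌋-false (x ≟ y) ne)

  words-ratio : ∀ n (N : T → ℕ) → (∀ t → N t ≢ 0 → t ∈ ts) → Σ[ N ∈ ts ] ≡ n →
    HasRatio (HasContent {n} N) Π[ (λ t → N t !) ∈ ts ] (n !)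
  words-ratio zero N supp sum≡0 =
    1 , ([ [] ] , ([] ∷ []) , (λ { [] → (λ _ t → sym (N≡0 t)) , λ _ → here refl }) , refl) ,
    trans (*-identityˡ _) (Prod.big-ε ts λ t _ → cong _! (N≡0 t))
    where
    N≡0 : ∀ t → N t ≡ 0
    N≡0 t with N t in e
    ... | zero  = refl
    ... | suc _ = trans (sym e) (Σ-0⇒0 ts sum≡0 (supp t λ z → 1+n≢0 (trans (sym e) z)))
  words-ratio (suc n) N supp sum≡ =
    let (K , hc , e) = HasRatio-Σ-list D (λ x → n ! * N x) ts uts first in
    K , HasCount-bijection (λ (x , w) → x ∷ w) (λ _ (_ , q) → q)
          (λ { (x , w) (.x , .w) _ _ refl → refl })
          (λ { (x ∷ w) q → (x , w) , (first∈ x w q , q) , refl }) hc ,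
    trans e (trans (Σ-*ˡ (n !) N ts) (trans (cong (n ! *_) sum≡) (*-comm (n !) (suc n))))
    where
    D : ℕ
    D = Π[ (λ t → N t !) ∈ ts ]
    first∈ : ∀ x w → HasContent {suc n} N (x ∷ w) → x ∈ ts
    first∈ x w q = supp x λ Nx≡0 → 1+n≢0
      (trans (cong (_+ occurrences w x) (sym (χ-yes {x} refl)))
             (trans (sym (occurrences-∷ x w x)) (trans (q x) Nx≡0)))
    first : ∀ x → x ∈ ts → HasRatio (λ w → HasContent {suc n} N (x ∷ w)) D (n ! * N x)
    first x x∈ with N x in Nx
    ... | zero  = 0 , ([] , [] , (λ w → (λ ()) , λ q → ⊥-elim (1+n≢0
      (trans (cong (_+ occurrences w x) (sym (χ-yes {x} refl)))
             (trans (sym (occurrences-∷ x w x)) (trans (q x) Nx))))) , refl) , sym (*-zeroʳ (n !))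
    ... | suc k =
      let (K , hc , e) = words-ratio n N′ supp′ sum′ in
      K , HasCount-bijection (λ w → w)
            (λ w q t → trans (occurrences-∷ x w t) (trans (cong (χ ⌊ x ≟ t ⌋ +_) (q t)) (N′+ t)))
            (λ _ _ _ _ p → p)
            (λ w q → w , (λ t → +-cancelˡ-≡ (χ ⌊ x ≟ t ⌋) _ _
                (trans (sym (occurrences-∷ x w t)) (trans (q t) (sym (N′+ t))))) , refl) hc ,
      (begin
        K * D                        ≡⟨ cong (K *_) D≡ ⟩
        K * (D′ * suc k)             ≡⟨ sym (*-assoc K D′ (suc k)) ⟩
        K * D′ * suc k               ≡⟨ cong (_* suc k) e ⟩
        n ! * suc k                  ∎)
      where
      N′ : T → ℕ
      N′ t = N t ∸ χ ⌊ x ≟ t ⌋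
      D′ : ℕ
      D′ = Π[ (λ t → N′ t !) ∈ ts ]
      N′+ : ∀ t → χ ⌊ x ≟ t ⌋ + N′ t ≡ N t
      N′+ t with x ≟ t
      ... | no _     = refl
      ... | yes refl = trans (cong (λ z → suc (z ∸ 1)) Nx) (sym Nx)
      supp′ : ∀ t → N′ t ≢ 0 → t ∈ ts
      supp′ t ne = supp t λ z → ne (trans (cong (_∸ χ ⌊ x ≟ t ⌋) z) (0∸n≡0 (χ ⌊ x ≟ t ⌋)))
      χ-sum : Σ[ (λ t → χ ⌊ x ≟ t ⌋) ∈ ts ] ≡ 1
      χ-sum = trans (Sum.big-single uts x∈ λ t _ t≢x → χ-no (t≢x ∘ sym)) (χ-yes refl)
      sum′ : Σ[ N′ ∈ ts ] ≡ n
      sum′ = suc-injective (begin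
        1 + Σ[ N′ ∈ ts ]                                ≡⟨ cong (_+ Σ[ N′ ∈ ts ]) (sym χ-sum) ⟩
        Σ[ (λ t → χ ⌊ x ≟ t ⌋) ∈ ts ] + Σ[ N′ ∈ ts ]    ≡⟨ sym (Sum.big-∙ _ N′ ts) ⟩
        Σ[ (λ t → χ ⌊ x ≟ t ⌋ + N′ t) ∈ ts ]            ≡⟨ Sum.big-cong ts N′+ ⟩
        Σ[ N ∈ ts ]                                     ≡⟨ sum≡ ⟩
        suc n                                           ∎)
      split : ∀ t → N t ! ≡ N′ t ! * (if ⌊ x ≟ t ⌋ then suc k else 1)
      split t with x ≟ t
      ... | no _     = sym (*-identityʳ _)
      ... | yes refl = trans (cong _! Nx) (trans (*-comm (suc k) (k !)) (cong (λ z → (z ∸ 1) ! * suc k) (sym Nx)))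
      D≡ : D ≡ D′ * suc k
      D≡ = trans (Prod.big-cong ts split) (trans (Prod.big-∙ _ _ ts) (cong (D′ *_)
        (trans (Prod.big-single uts x∈ λ t _ t≢x → if-no _≟_ (t≢x ∘ sym)) (if-yes _≟_ refl))))

  module _ {n} {N : T → ℕ} (supp : ∀ t → N t ≢ 0 → t ∈ ts) (w : Vec T n) (content : HasContent N w) where

    letter-occurs : ∀ v → N (lookup w v) ≢ 0
    letter-occurs v Nt≡0 = 1+n≢0 (trans (sym (χ-yes refl))
      (Σ-0⇒0 (allFin n) (trans (content (lookup w v)) Nt≡0) (∈-allFin v)))

    Σ-letters : (φ : T → ℕ) → Σ[ (λ v → φ (lookup w v)) ∈ allFin n ] ≡ Σ[ (λ t → φ t * N t) ∈ ts ]
    Σ-letters φ = begin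
      Σ[ (λ v → φ (lookup w v)) ∈ allFin n ]
        ≡⟨ sym (Sum.big-by-key _≟_ (lookup w) _ (allFin n) ts uts λ v _ → inj₁ (supp _ (letter-occurs v))) ⟩
      Σ[ (λ t → Σ[ (λ v → if ⌊ lookup w v ≟ t ⌋ then φ (lookup w v) else 0) ∈ allFin n ]) ∈ ts ]
        ≡⟨ Sum.big-cong ts (λ t → trans (Sum.big-cong (allFin n) (λ v → pointwise t v))
             (trans (Σ-*ˡ (φ t) _ (allFin n)) (cong (φ t *_) (content t)))) ⟩
      Σ[ (λ t → φ t * N t) ∈ ts ] ∎
      where
      pointwise : ∀ t v → (if ⌊ lookup w v ≟ t ⌋ then φ (lookup w v) else 0) ≡ φ t * χ ⌊ lookup w v ≟ t ⌋
      pointwise t v with lookup w v ≟ t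
      ... | yes refl = sym (*-identityʳ _)
      ... | no _     = sym (*-zeroʳ (φ t))

-- Falling factorials and subsets

P′-suc : ∀ n k → suc n P′ suc k ≡ suc n * (n P′ k)
P′-suc n zero    = refl
P′-suc n (suc k) = trans (cong ((n ∸ k) *_) (P′-suc n k)) (x∙yz≈y∙xz (n ∸ k) (suc n) (n P′ k))

P′-+ : ∀ n c d → n P′ (c + d) ≡ (n P′ c) * ((n ∸ c) P′ d)
P′-+ n c zero    = trans (cong (n P′_) (+-identityʳ c)) (sym (*-identityʳ _))
P′-+ n c (suc d) = begin
  n P′ (c + suc d)                          ≡⟨ cong (n P′_) (+-suc c d) ⟩
  (n ∸ (c + d)) * (n P′ (c + d))            ≡⟨ cong₂ _*_ (sym (∸-+-assoc n c d)) (P′-+ n c d) ⟩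
  (n ∸ c ∸ d) * ((n P′ c) * ((n ∸ c) P′ d)) ≡⟨ x∙yz≈y∙xz (n ∸ c ∸ d) (n P′ c) _ ⟩
  (n P′ c) * ((n ∸ c) P′ suc d)             ∎

P′-self : ∀ n → n P′ n ≡ n !
P′-self zero    = refl
P′-self (suc n) = trans (P′-suc n n) (cong (suc n *_) (P′-self n))

n<k⇒P′≡0 : ∀ {n k} → n < k → n P′ k ≡ 0
n<k⇒P′≡0 {n} {suc k} n<1+k = cong (_* (n P′ k)) (m≤n⇒m∸n≡0 (s≤s⁻¹ n<1+k))

P′-pascal : ∀ n k → suc n P′ suc k ≡ n P′ suc k + suc k * (n P′ k)
P′-pascal n k with k ≤? n
... | yes k≤n = trans (P′-suc n k) (trans (cong (_* (n P′ k)) (sym (trans (+-suc (n ∸ k) k) (cong suc (m∸n+n≡m k≤n)))))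
                  (*-distribʳ-+ (n P′ k) (n ∸ k) (suc k)))
... | no k≰n rewrite P′-suc n k | n<k⇒P′≡0 (≰⇒> k≰n) =
  trans (*-zeroʳ n) (sym (cong₂ _+_ (*-zeroʳ (n ∸ k)) (*-zeroʳ k)))

# : ∀ {n} → (Fin n → Bool) → ℕ
# {n} p = Σ[ (λ v → χ (p v)) ∈ allFin n ]

SubsetOf : ∀ {n} → (Fin n → Bool) → ℕ → Vec Bool n → Set
SubsetOf p c U = (∀ u → lookup U u ≡ true → p u ≡ true) × # (lookup U) ≡ c

subsets-ratio : ∀ n (p : Fin n → Bool) c → HasRatio (SubsetOf p c) (c !) (# p P′ c)
subsets-ratio zero p zero =
  1 , ([ [] ] , ([] ∷ []) , (λ { [] → (λ _ → (λ ()) , refl) , λ _ → here refl }) , refl) , refl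
subsets-ratio zero p (suc c) =
  0 , ([] , [] , (λ { [] → (λ ()) , λ () }) , refl) , sym (n<k⇒P′≡0 {0} {suc c} z<s)
subsets-ratio (suc n) p c = by-first (p zero) refl
  where
  p′ : Fin n → Bool
  p′ = p ∘ suc
  #∷ : ∀ b (U : Vec Bool n) → # (lookup (b ∷ U)) ≡ χ b + # (lookup U)
  #∷ b U = Sum.big-allFin-suc (χ ∘ lookup (b ∷ U))
  cons : ∀ {b c} {U : Vec Bool n} → (b ≡ true → p zero ≡ true) → SubsetOf p′ c U → SubsetOf p (χ b + c) (b ∷ U)
  cons {b} {U = U} pb (sub , card) =
    (λ { zero e → pb e ; (suc u) e → sub u e }) , trans (#∷ b U) (cong (χ b +_) card)
  uncons : ∀ {b c} {U : Vec Bool n} → SubsetOf p c (b ∷ U) → SubsetOf p′ (c ∸ χ b) U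
  uncons {b} {U = U} (sub , card) =
    (λ u → sub (suc u)) , trans (sym (m+n∸m≡n (χ b) _)) (cong (_∸ χ b) (trans (sym (#∷ b U)) card))
  inj : ∀ {b} {xs ys : Vec Bool n} → b ∷ xs ≡ b ∷ ys → xs ≡ ys
  inj refl = refl
  #p : # p ≡ χ (p zero) + # p′
  #p = Sum.big-allFin-suc (χ ∘ p)
  by-first : ∀ b → p zero ≡ b → HasRatio (SubsetOf p c) (c !) (# p P′ c)
  by-first false p0 with subsets-ratio n p′ c
  ... | K , hc , e =
    K , HasCount-bijection (false ∷_) (λ U → cons (λ ())) (λ _ _ _ _ → inj) onto hc ,
    trans e (cong (_P′ c) (sym (trans #p (cong (λ z → χ z + # p′) p0))))
    where
    onto : ∀ U → SubsetOf p c U → Σ (Vec Bool n) λ U′ → SubsetOf p′ c U′ × false ∷ U′ ≡ U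
    onto (false ∷ U) s = U , uncons s , refl
    onto (true ∷ U) (sub , _) with () ← trans (sym p0) (sub zero refl)
  by-first true p0 = helper c
    where
    helper : ∀ c → HasRatio (SubsetOf p c) (c !) (# p P′ c)
    helper zero with subsets-ratio n p′ 0
    ... | K , hc , e = K , HasCount-bijection (false ∷_) (λ U → cons (λ ())) (λ _ _ _ _ → inj) onto hc , e
      where
      onto : ∀ U → SubsetOf p 0 U → Σ (Vec Bool n) λ U′ → SubsetOf p′ 0 U′ × false ∷ U′ ≡ U
      onto (false ∷ U) s = U , uncons s , refl
      onto (true ∷ U) (_ , card) with () ← trans (sym (#∷ true U)) card
    helper (suc c) with subsets-ratio n p′ (suc c) | subsets-ratio n p′ c
    ... | K , (L , uL , L↔ , len) , e | K′ , (L′ , uL′ , L′↔ , len′) , e′ =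
      K + K′ ,
      (map (false ∷_) L ++ map (true ∷_) L′ ,
       Unique.++⁺ (Unique.map⁺ inj uL) (Unique.map⁺ inj uL′) disjoint ,
       (λ U → to U , from U) ,
       trans (length-++ (map (false ∷_) L)) (cong₂ _+_ (trans (length-map _ L) len) (trans (length-map _ L′) len′))) ,
      (begin
        (K + K′) * (suc c) !                         ≡⟨ *-distribʳ-+ ((suc c) !) K K′ ⟩
        K * (suc c) ! + K′ * (suc c * c !)           ≡⟨ cong₂ _+_ e (x∙yz≈y∙xz K′ (suc c) (c !)) ⟩
        (# p′ P′ suc c) + suc c * (K′ * c !)         ≡⟨ cong (λ z → (# p′ P′ suc c) + suc c * z) e′ ⟩
        (# p′ P′ suc c) + suc c * (# p′ P′ c)        ≡⟨ sym (P′-pascal (# p′) c) ⟩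
        suc (# p′) P′ suc c                          ≡⟨ cong (_P′ suc c) (sym (trans #p (cong (λ z → χ z + # p′) p0))) ⟩
        # p P′ suc c                                 ∎)
      where
      disjoint : ∀ {U} → ¬ (U ∈ map (false ∷_) L × U ∈ map (true ∷_) L′)
      disjoint (U∈ , U∈′) with ∈-map⁻ (false ∷_) U∈ | ∈-map⁻ (true ∷_) U∈′
      ... | (_ , _ , refl) | (_ , _ , ())
      to : ∀ U → U ∈ map (false ∷_) L ++ map (true ∷_) L′ → SubsetOf p (suc c) U
      to U U∈ with ∈-++⁻ (map (false ∷_) L) U∈
      ... | inj₁ U∈₁ with ∈-map⁻ (false ∷_) U∈₁
      ...   | (U′ , U′∈ , refl) = cons (λ ()) (proj₁ (L↔ U′) U′∈)
      to U U∈ | inj₂ U∈₂ with ∈-map⁻ (true ∷_) U∈₂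
      ...   | (U′ , U′∈ , refl) = cons (λ _ → p0) (proj₁ (L′↔ U′) U′∈)
      from : ∀ U → SubsetOf p (suc c) U → U ∈ map (false ∷_) L ++ map (true ∷_) L′
      from (false ∷ U) s = ∈-++⁺ˡ (∈-map⁺ (false ∷_) (proj₂ (L↔ U) (uncons s)))
      from (true ∷ U)  s = ∈-++⁺ʳ (map (false ∷_) L) (∈-map⁺ (true ∷_) (proj₂ (L′↔ U) (uncons s)))

lookup-ext : ∀ {n} {xs ys : Vec A n} → (∀ i → lookup xs i ≡ lookup ys i) → xs ≡ ys
lookup-ext e = trans (sym (Vec.tabulate∘lookup _)) (trans (Vec.tabulate-cong e) (Vec.tabulate∘lookup _))

#-cong : ∀ {n} {p q : Fin n → Bool} → (∀ u → p u ≡ q u) → # p ≡ # q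
#-cong {n} e = Sum.big-cong (allFin n) (λ u → cong χ (e u))

#-pos : ∀ {n} {p : Fin n → Bool} {u} → p u ≡ true → # p ≢ 0
#-pos {n} {p} {u} pu #p≡0 = 1+n≢0 (trans (sym (cong χ pu)) (Σ-0⇒0 (allFin n) #p≡0 (∈-allFin u)))

#-empty : ∀ {n} {p : Fin n → Bool} → (∀ u → p u ≡ false) → # p ≡ 0
#-empty {n} e = Sum.big-ε (allFin n) (λ u _ → cong χ (e u))

-- Forests

-- A forest is encoded by its parent vector; the roots are its fixed points.
data Root {n} (f : Vec (Fin n) n) : Fin n → Fin n → Set where
  stop : ∀ {w} → lookup f w ≡ w → Root f w w
  step : ∀ {x w} → Root f (lookup f x) w → Root f x w

module _ {n} {f : Vec (Fin n) n} where

  Root-fixed : ∀ {x w} → Root f x w → lookup f w ≡ w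
  Root-fixed (stop e) = e
  Root-fixed (step r) = Root-fixed r

  Root-of-fixed : ∀ {x w} → lookup f x ≡ x → Root f x w → w ≡ x
  Root-of-fixed e (stop _) = refl
  Root-of-fixed e (step r) = trans (Root-of-fixed (cong (lookup f) e) r) e

  Root-functional : ∀ {x w w′} → Root f x w → Root f x w′ → w ≡ w′
  Root-functional (stop e) r′        = sym (Root-of-fixed e r′)
  Root-functional (step r) (stop e)  = Root-of-fixed e (step r)
  Root-functional (step r) (step r′) = Root-functional r r′

  Root-invariant : (P : Fin n → Set) → (∀ u → lookup f u ≢ u → P u → P (lookup f u)) →
    ∀ {x w} → Root f x w → P x → P w
  Root-invariant P pres (stop _) px = px
  Root-invariant P pres {x} (step r) px with lookup f x Fin.≟ x
  ... | yes e = Root-invariant P pres r (subst P (sym e) px)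
  ... | no ne = Root-invariant P pres r (pres x ne px)

module Forests {Colour : Set} (_≟_ : DecidableEquality Colour) {n : ℕ}
  (a : Fin n → Colour) (c : Fin n → Colour → ℕ) where

  child? : (f : Vec (Fin n) n) (v : Fin n) (k : Colour) (u : Fin n) →
    Dec (lookup f u ≢ u × lookup f u ≡ v × a u ≡ k)
  child? f v k u = ¬? (lookup f u Fin.≟ u) ×-dec (lookup f u Fin.≟ v) ×-dec (a u ≟ k)

  children : Vec (Fin n) n → Fin n → Colour → ℕ
  children f v k = # (λ u → ⌊ child? f v k u ⌋)

  -- A group (v , k) stands for the set of all children of v with colour k, and
  -- c v k is the prescribed size of that set.
  record PartialForest (G : List (Fin n × Colour)) (f : Vec (Fin n) n) : Set where
    field
      forest : ∀ v → ∃ (Root f v)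
      only   : ∀ u → lookup f u ≢ u → (lookup f u , a u) ∈ G
      full   : ∀ {v k} → (v , k) ∈ G → children f v k ≡ c v k

    c≢0 : ∀ u → lookup f u ≢ u → c (lookup f u) (a u) ≢ 0
    c≢0 u ne c≡0 = #-pos {p = λ x → ⌊ child? f (lookup f u) (a u) x ⌋}
      (⌊⌋-true (child? f (lookup f u) (a u) u) (ne , refl , refl))
      (trans (full (only u ne)) c≡0)

  open PartialForest

  empty-ratio : HasRatio (PartialForest []) 1 1
  empty-ratio = 1 , ([ tabulate id ] , ([] ∷ []) , (λ f → to f , from f) , refl) , refl
    where
    to : ∀ f → f ∈ [ tabulate id ] → PartialForest [] f
    to f (here refl) = record
      { forest = λ v → v , stop (lookup∘tabulate id v)
      ; only   = λ u ne → ⊥-elim (ne (lookup∘tabulate id u))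
      ; full   = λ () }
    from : ∀ f → PartialForest [] f → f ∈ [ tabulate id ]
    from f F = here (lookup-ext λ u → trans (fixed u) (sym (lookup∘tabulate id u)))
      where
      fixed : ∀ u → lookup f u ≡ u
      fixed u with lookup f u Fin.≟ u
      ... | yes e = e
      ... | no ne with () ← only F u ne

  root? : (f : Vec (Fin n) n) (k : Colour) (u : Fin n) → Dec (lookup f u ≡ u × a u ≡ k)
  root? f k u = (lookup f u Fin.≟ u) ×-dec (a u ≟ k)

  available? : (f : Vec (Fin n) n) (k : Colour) (w u : Fin n) →
    Dec ((lookup f u ≡ u × a u ≡ k) × u ≢ w)
  available? f k w u = root? f k u ×-dec ¬? (u Fin.≟ w)

  module AddGroup (v : Fin n) (k : Colour) (G : List (Fin n × Colour)) (vk∉G : (v , k) ∉ G) where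

    Choice : Vec (Fin n) n → Vec Bool n → Set
    Choice f U = (∀ u → lookup U u ≡ true → lookup f u ≡ u × a u ≡ k × ¬ Root f v u)
      × # (lookup U) ≡ c v k

    attach : Vec (Fin n) n × Vec Bool n → Vec (Fin n) n
    attach (f , U) = tabulate λ u → if lookup U u then v else lookup f u

    module _ {f : Vec (Fin n) n} {U : Vec Bool n} where

      attach-in : ∀ {u} → lookup U u ≡ true → lookup (attach (f , U)) u ≡ v
      attach-in {u} e = trans (lookup∘tabulate _ u) (cong (if_then v else lookup f u) e)

      attach-out : ∀ {u} → lookup U u ≡ false → lookup (attach (f , U)) u ≡ lookup f u
      attach-out {u} e = trans (lookup∘tabulate _ u) (cong (if_then v else lookup f u) e)

      module _ (F : PartialForest G f) (Ch : Choice f U) where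

        private
          f′ = attach (f , U)

        attach-child : ∀ u → ⌊ child? f′ v k u ⌋ ≡ lookup U u
        attach-child u with bool (lookup U u)
        ... | inj₁ e = trans (⌊⌋-true (child? f′ v k u) (≢u , attach-in e , proj₁ (proj₂ (proj₁ Ch u e)))) (sym e)
          where
          ≢u : lookup f′ u ≢ u
          ≢u fu≡u with trans (sym (attach-in e)) fu≡u
          ... | refl = proj₂ (proj₂ (proj₁ Ch u e)) (stop (proj₁ (proj₁ Ch u e)))
        ... | inj₂ e = trans (⌊⌋-false (child? f′ v k u) not-child) (sym e)
          where
          not-child : ¬ (lookup f′ u ≢ u × lookup f′ u ≡ v × a u ≡ k)
          not-child (ne , e₁ , e₂) = vk∉G (subst (_∈ G) (cong₂ _,_ (trans (sym (attach-out e)) e₁) e₂)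
            (only F u (λ fu≡u → ne (trans (attach-out e) fu≡u))))

        attach-root-v : ∀ {x w} → Root f x w → lookup U w ≡ false → Root f′ x w
        attach-root-v (stop e) Uw = stop (trans (attach-out Uw) e)
        attach-root-v {x} {w} (step r) Uw with bool (lookup U x)
        ... | inj₂ e = step (subst (λ z → Root f′ z w) (sym (attach-out e)) (attach-root-v r Uw))
        ... | inj₁ e with Root-of-fixed {f = f} (proj₁ (proj₁ Ch x e)) (step r)
        ...   | refl = ⊥-elim (true≢false e Uw)

        attach-root : ∀ {x w} → Root f x w → ∃ (Root f′ x)
        attach-root {x} r with bool (lookup U x)
        ... | inj₁ e with forest F v
        ...   | (w₀ , r₀) = w₀ , step (subst (λ z → Root f′ z w₀) (sym (attach-in e)) (attach-root-v r₀ Uw₀))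
          where
          Uw₀ : lookup U w₀ ≡ false
          Uw₀ with bool (lookup U w₀)
          ... | inj₂ e′ = e′
          ... | inj₁ e′ = ⊥-elim (proj₂ (proj₂ (proj₁ Ch w₀ e′)) r₀)
        attach-root {x} (stop e₀) | inj₂ e = x , stop (trans (attach-out e) e₀)
        attach-root {x} (step r) | inj₂ e with attach-root r
        ... | (w′ , r′) = w′ , step (subst (λ z → Root f′ z w′) (sym (attach-out e)) r′)

        attach-into : PartialForest ((v , k) ∷ G) f′
        attach-into .forest x = attach-root (proj₂ (forest F x))
        attach-into .only u ne with bool (lookup U u)
        ... | inj₁ e = here (cong₂ _,_ (attach-in e) (proj₁ (proj₂ (proj₁ Ch u e))))
        ... | inj₂ e = there (subst (λ z → (z , a u) ∈ G) (sym (attach-out e))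
                         (only F u (λ fu≡u → ne (trans (attach-out e) fu≡u))))
        attach-into .full (here refl) = trans (#-cong attach-child) (proj₂ Ch)
        attach-into .full {v′} {k′} (there g∈) = trans (#-cong same) (full F g∈)
          where
          same : ∀ u → ⌊ child? f′ v′ k′ u ⌋ ≡ ⌊ child? f v′ k′ u ⌋
          same u with bool (lookup U u)
          ... | inj₂ e = cong (λ z → ⌊ ¬? (z Fin.≟ u) ×-dec (z Fin.≟ v′) ×-dec (a u ≟ k′) ⌋) (attach-out e)
          ... | inj₁ e = trans (⌊⌋-false (child? f′ v′ k′ u) λ { (_ , refl , refl) →
                           vk∉G (subst (_∈ G) (cong₂ _,_ (attach-in e) (proj₁ (proj₂ (proj₁ Ch u e)))) g∈) })
                         (sym (⌊⌋-false (child? f v′ k′ u) λ (ne , _) → ne (proj₁ (proj₁ Ch u e))))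

    attach-injective : ∀ x y → PartialForest G (proj₁ x) × Choice (proj₁ x) (proj₂ x) →
      PartialForest G (proj₁ y) × Choice (proj₁ y) (proj₂ y) → attach x ≡ attach y → x ≡ y
    attach-injective (f , U) (g , V) (F , Ch) (F′ , Ch′) eq = cong₂ _,_ f≡g U≡V
      where
      U≡V : U ≡ V
      U≡V = lookup-ext λ u → trans (sym (attach-child {f} {U} F Ch u))
        (trans (cong (λ z → ⌊ child? z v k u ⌋) eq) (attach-child {g} {V} F′ Ch′ u))
      f≡g : f ≡ g
      f≡g = lookup-ext pointwise
        where
        pointwise : ∀ u → lookup f u ≡ lookup g u
        pointwise u with bool (lookup U u)
        ... | inj₁ e = trans (proj₁ (proj₁ Ch u e))
                         (sym (proj₁ (proj₁ Ch′ u (trans (cong (λ W → lookup W u) (sym U≡V)) e))))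
        ... | inj₂ e = trans (sym (attach-out {f} {U} e)) (trans (cong (λ z → lookup z u) eq)
                         (attach-out {g} {V} (trans (cong (λ W → lookup W u) (sym U≡V)) e)))

    module _ {f′ : Vec (Fin n) n} (F′ : PartialForest ((v , k) ∷ G) f′) where

      private
        U : Vec Bool n
        U = tabulate λ u → ⌊ child? f′ v k u ⌋
        f : Vec (Fin n) n
        f = tabulate λ u → if ⌊ child? f′ v k u ⌋ then u else lookup f′ u

        f-in : ∀ {u} → ⌊ child? f′ v k u ⌋ ≡ true → lookup f u ≡ u
        f-in {u} e = trans (lookup∘tabulate _ u) (cong (if_then u else lookup f′ u) e)

        f-out : ∀ {u} → ⌊ child? f′ v k u ⌋ ≡ false → lookup f u ≡ lookup f′ u
        f-out {u} e = trans (lookup∘tabulate _ u) (cong (if_then u else lookup f′ u) e)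

        detach-root : ∀ {x w} → Root f′ x w → ∃ (Root f x)
        detach-root {x} r with bool ⌊ child? f′ v k x ⌋
        ... | inj₁ e = x , stop (f-in e)
        detach-root {x} (stop e₀) | inj₂ e = x , stop (trans (f-out e) e₀)
        detach-root {x} (step r) | inj₂ e with detach-root r
        ... | (w , r′) = w , step (subst (λ z → Root f z w) (sym (f-out e)) r′)

        detached : PartialForest G f
        detached .forest x = detach-root (proj₂ (forest F′ x))
        detached .only u ne with bool ⌊ child? f′ v k u ⌋
        ... | inj₁ e = ⊥-elim (ne (f-in e))
        ... | inj₂ e with only F′ u (λ e′ → ne (trans (f-out e) e′))
        ...   | there g∈ = subst (λ z → (z , a u) ∈ G) (sym (f-out e)) g∈
        ...   | here g≡ = ⊥-elim (⌊⌋-false⁻¹ (child? f′ v k u) e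
                  ((λ e′ → ne (trans (f-out e) e′)) , Product.,-injective g≡))
        detached .full {v′} {k′} g∈ = trans (#-cong same) (full F′ (there g∈))
          where
          same : ∀ u → ⌊ child? f v′ k′ u ⌋ ≡ ⌊ child? f′ v′ k′ u ⌋
          same u with bool ⌊ child? f′ v k u ⌋
          ... | inj₂ e = cong (λ z → ⌊ ¬? (z Fin.≟ u) ×-dec (z Fin.≟ v′) ×-dec (a u ≟ k′) ⌋) (f-out e)
          ... | inj₁ e = trans (⌊⌋-false (child? f v′ k′ u) λ (ne , _) → ne (f-in e))
                (sym (⌊⌋-false (child? f′ v′ k′ u) λ { (_ , refl , refl) →
                  let (_ , e₁ , e₂) = ⌊⌋-true⁻¹ (child? f′ v k u) e in
                  vk∉G (subst (_∈ G) (cong₂ _,_ e₁ e₂) g∈) }))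

        -- If u is attached below v but is also the root of v once detached, then following
        -- parents in f′ from u never leaves the set of vertices with root u in f.
        no-cycle : ∀ {u} → ⌊ child? f′ v k u ⌋ ≡ true → Root f v u → ∀ {x w} → Root f x u → ¬ Root f′ x w
        no-cycle {u} e r {x} rx (stop fx≡x) with bool ⌊ child? f′ v k x ⌋
        ... | inj₁ ex = proj₁ (⌊⌋-true⁻¹ (child? f′ v k x) ex) fx≡x
        ... | inj₂ ex with Root-of-fixed (trans (f-out ex) fx≡x) rx
        ...   | refl = true≢false e ex
        no-cycle {u} e r {x} rx (step r′) with bool ⌊ child? f′ v k x ⌋
        ... | inj₁ ex = no-cycle e r
          (subst (λ z → Root f z u) (sym (proj₁ (proj₂ (⌊⌋-true⁻¹ (child? f′ v k x) ex)))) r) r′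
        no-cycle {u} e r {x} (stop _) (step r′) | inj₂ ex = true≢false e ex
        no-cycle {u} e r {x} (step rx) (step r′) | inj₂ ex =
          no-cycle e r (subst (λ z → Root f z u) (f-out ex) rx) r′

        choice : Choice f U
        choice = (λ u e → let e′ = trans (sym (lookup∘tabulate _ u)) e in
                   f-in e′ , proj₂ (proj₂ (⌊⌋-true⁻¹ (child? f′ v k u) e′)) ,
                   λ r → no-cycle e′ r (stop (f-in e′)) (proj₂ (forest F′ u)))
               , trans (#-cong {p = lookup U} (lookup∘tabulate _)) (full F′ (here refl))

      attach-onto : Σ (Vec (Fin n) n × Vec Bool n) λ (f , U) → (PartialForest G f × Choice f U) × attach (f , U) ≡ f′
      attach-onto = (f , U) , (detached , choice) , lookup-ext pointwise
        where
        pointwise : ∀ u → lookup (attach (f , U)) u ≡ lookup f′ u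
        pointwise u with bool ⌊ child? f′ v k u ⌋
        ... | inj₁ e = trans (attach-in {f} {U} (trans (lookup∘tabulate _ u) e))
                         (sym (proj₁ (proj₂ (⌊⌋-true⁻¹ (child? f′ v k u) e))))
        ... | inj₂ e = trans (attach-out {f} {U} (trans (lookup∘tabulate _ u) e)) (f-out e)

    add-group-ratio : ∀ {D M} X →
      (∀ f → PartialForest G f → ∀ w → Root f v w → # (λ u → ⌊ available? f k w u ⌋) ≡ X) →
      HasRatio (PartialForest G) D M →
      HasRatio (PartialForest ((v , k) ∷ G)) (D * c v k !) (M * (X P′ c v k))
    add-group-ratio X avail R = HasRatio-bijection attach (λ (f , U) (F , Ch) → attach-into {f} {U} F Ch)
      attach-injective (λ _ F′ → attach-onto F′) (HasRatio-Σ R choices)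
      where
      choices : ∀ f → PartialForest G f → HasRatio (Choice f) (c v k !) (X P′ c v k)
      choices f F with forest F v
      ... | (w , r) = HasRatio-bijection {P = SubsetOf p (c v k)} {Q = Choice f} id
        (λ U (sub , card) → (λ u e → let ((e₁ , e₂) , ne) = ⌊⌋-true⁻¹ (available? f k w u) (sub u e) in
             e₁ , e₂ , λ r′ → ne (Root-functional r′ r)) , card)
        (λ _ _ _ _ e → e)
        (λ U (ch , card) → U , ((λ u e → let (e₁ , e₂ , ¬r) = ch u e in
             ⌊⌋-true (available? f k w u) ((e₁ , e₂) , λ { refl → ¬r r })) , card) , refl)
        (subst (λ z → HasRatio (SubsetOf p (c v k)) (c v k !) (z P′ c v k)) (avail f F w r) (subsets-ratio n p (c v k)))
        where
        p : Fin n → Bool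
        p u = ⌊ available? f k w u ⌋

-- Elimination of colours

module Elimination {Colour : Set} (_≟_ : DecidableEquality Colour) {n : ℕ}
  (a : Fin n → Colour) (c : Fin n → Colour → ℕ) (h : Colour → Colour → Bool) where

  open Forests _≟_ a c public
  open PartialForest

  size : Colour → ℕ
  size k = # (λ u → ⌊ a u ≟ k ⌋)

  demand : Colour → ℕ
  demand k = Σ[ (λ v → c v k) ∈ allFin n ]

  roots-count : ∀ {G f} k (vs : List (Fin n)) → Unique vs →
    (∀ v → (v , k) ∈ G → v ∈ vs) → (∀ v → v ∈ vs → (v , k) ∈ G) → PartialForest G f →
    # (λ u → ⌊ root? f k u ⌋) + Σ[ (λ v → c v k) ∈ vs ] ≡ size k
  roots-count {G} {f} k vs uvs G⊆ ⊆G F = begin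
    # (λ u → ⌊ root? f k u ⌋) + Σ[ (λ v → c v k) ∈ vs ]
      ≡⟨ cong (# (λ u → ⌊ root? f k u ⌋) +_) (Sum.big-cong-∈ vs λ v v∈ → sym (full F (⊆G v v∈))) ⟩
    # (λ u → ⌊ root? f k u ⌋) + Σ[ (λ v → children f v k) ∈ vs ]
      ≡⟨ cong (# (λ u → ⌊ root? f k u ⌋) +_) (Sum.big-cong vs λ v → Sum.big-cong (allFin n) (child-key v)) ⟩
    # (λ u → ⌊ root? f k u ⌋) +
      Σ[ (λ v → Σ[ (λ u → if ⌊ lookup f u Fin.≟ v ⌋ then χ ⌊ nonroot? u ⌋ else 0) ∈ allFin n ]) ∈ vs ]
      ≡⟨ cong (# (λ u → ⌊ root? f k u ⌋) +_) (Sum.big-by-key Fin._≟_ (lookup f) _ (allFin n) vs uvs λ u _ → key∈ u) ⟩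
    # (λ u → ⌊ root? f k u ⌋) + # (λ u → ⌊ nonroot? u ⌋)
      ≡⟨ sym (Sum.big-∙ _ _ (allFin n)) ⟩
    Σ[ (λ u → χ ⌊ root? f k u ⌋ + χ ⌊ nonroot? u ⌋) ∈ allFin n ]
      ≡⟨ Sum.big-cong (allFin n) split ⟩
    size k ∎
    where
    nonroot? : ∀ u → Dec (lookup f u ≢ u × a u ≡ k)
    nonroot? u = ¬? (lookup f u Fin.≟ u) ×-dec (a u ≟ k)
    child-key : ∀ v u → χ ⌊ child? f v k u ⌋ ≡ (if ⌊ lookup f u Fin.≟ v ⌋ then χ ⌊ nonroot? u ⌋ else 0)
    child-key v u with lookup f u Fin.≟ v | lookup f u Fin.≟ u | a u ≟ k
    ... | yes _ | yes _ | _     = refl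
    ... | yes _ | no _  | yes _ = refl
    ... | yes _ | no _  | no _  = refl
    ... | no _  | yes _ | _     = refl
    ... | no _  | no _  | _     = refl
    key∈ : ∀ u → lookup f u ∈ vs ⊎ χ ⌊ nonroot? u ⌋ ≡ 0
    key∈ u with nonroot? u
    ... | no _ = inj₂ refl
    ... | yes (ne , refl) = inj₁ (G⊆ _ (only F u ne))
    split : ∀ u → χ ⌊ root? f k u ⌋ + χ ⌊ nonroot? u ⌋ ≡ χ ⌊ a u ≟ k ⌋
    split u with lookup f u Fin.≟ u | a u ≟ k
    ... | yes _ | yes _ = refl
    ... | yes _ | no _  = refl
    ... | no _  | yes _ = refl
    ... | no _  | no _  = refl

  no-roots : ∀ {G f e} → (∀ v → (v , e) ∈ G) → demand e ≡ size e → PartialForest G f →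
    ∀ {u} → a u ≡ e → lookup f u ≢ u
  no-roots {G} {f} {e} all∈G d≡s F {u} au≡e fu≡u =
    #-pos {p = λ x → ⌊ root? f e x ⌋} (⌊⌋-true (root? f e u) (fu≡u , au≡e))
      (+-cancelʳ-≡ (demand e) _ 0 (trans
        (roots-count e (allFin n) (Unique.allFin⁺ n) (λ v _ → ∈-allFin v) (λ v _ → all∈G v) F) (sym d≡s)))

  inner outer order : Colour → List (Fin n)
  inner k = filter (λ v → T? (h k (a v))) (allFin n)
  outer k = filter (λ v → T? (not (h k (a v)))) (allFin n)
  order k = outer k ++ inner k

  ∈-inner⁻ : ∀ {k v} → v ∈ inner k → h k (a v) ≡ true
  ∈-inner⁻ {k} {v} v∈ with h k (a v) | proj₂ (∈-filter⁻ (λ v → T? (h k (a v))) {xs = allFin n} v∈)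
  ... | true | _ = refl

  ∈-outer⁻ : ∀ {k v} → v ∈ outer k → h k (a v) ≡ false
  ∈-outer⁻ {k} {v} v∈ with h k (a v) | proj₂ (∈-filter⁻ (λ v → T? (not (h k (a v)))) {xs = allFin n} v∈)
  ... | false | _ = refl

  ∈-order : ∀ k v → v ∈ order k
  ∈-order k v with bool (h k (a v))
  ... | inj₁ e = ∈-++⁺ʳ (outer k) (∈-filter⁺ (λ v → T? (h k (a v))) (∈-allFin v) (subst T (sym e) _))
  ... | inj₂ e = ∈-++⁺ˡ (∈-filter⁺ (λ v → T? (not (h k (a v)))) (∈-allFin v) (subst (T ∘ not) (sym e) _))

  inner-unique : ∀ k → Unique (inner k)
  inner-unique k = Unique.filter⁺ (λ v → T? (h k (a v))) (Unique.allFin⁺ n)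

  order-unique : ∀ k → Unique (order k)
  order-unique k = Unique.++⁺ (Unique.filter⁺ (λ v → T? (not (h k (a v)))) (Unique.allFin⁺ n))
    (inner-unique k) λ (v∈ , v∈′) → true≢false (∈-inner⁻ v∈′) (∈-outer⁻ v∈)

  groups : List Colour → List (Fin n × Colour)
  groups []      = []
  groups (k ∷ E) = map (_, k) (order k) ++ groups E

  ∈-groups⁺ : ∀ {k E} → k ∈ E → ∀ v → (v , k) ∈ groups E
  ∈-groups⁺ {k} (here refl)      v = ∈-++⁺ˡ (∈-map⁺ (_, k) (∈-order k v))
  ∈-groups⁺ {E = e ∷ _} (there k∈) v = ∈-++⁺ʳ (map (_, e) (order e)) (∈-groups⁺ k∈ v)

  ∈-groups⁻ : ∀ {E v k} → (v , k) ∈ groups E → k ∈ E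
  ∈-groups⁻ {e ∷ E} g∈ with ∈-++⁻ (map (_, e) (order e)) g∈
  ... | inj₂ g∈₂ = there (∈-groups⁻ g∈₂)
  ... | inj₁ g∈₁ with ∈-map⁻ (_, e) g∈₁
  ...   | (_ , _ , refl) = here refl

  -- Once the colours in E are exhausted, h k x tells whether the component of a vertex
  -- of colour x has a root of colour k.
  record Eliminable (k : Colour) (E : List Colour) : Set where
    field
      new       : k ∉ E
      exhausted : ∀ e → e ∈ E → demand e ≡ size e
      invariant : ∀ v e → e ∈ E → c v e ≢ 0 → h k (a v) ≡ h k e
      at-roots  : ∀ u → a u ∉ E → h k (a u) ≡ ⌊ a u ≟ k ⌋
      at-self   : h k k ≡ true

  module _ {k : Colour} {E : List Colour} (elim : Eliminable k E) where

    open Eliminable elim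

    private
      G : List (Fin n) → List (Fin n × Colour)
      G vs = map (_, k) vs ++ groups E

    ∈-G⁻ : ∀ vs {v e} → (v , e) ∈ G vs → (v ∈ vs × e ≡ k) ⊎ e ∈ E
    ∈-G⁻ vs g∈ with ∈-++⁻ (map (_, k) vs) g∈
    ... | inj₂ g∈₂ = inj₂ (∈-groups⁻ g∈₂)
    ... | inj₁ g∈₁ with ∈-map⁻ (_, k) g∈₁
    ...   | (_ , v∈ , refl) = inj₁ (v∈ , refl)

    module _ (β : Bool) {vs : List (Fin n)} (uvs : Unique vs)
      (vs-inner : β ≡ true → ∀ v → v ∈ vs → h k (a v) ≡ true)
      {f : Vec (Fin n) n} (F : PartialForest (G vs) f) where

      root-colour : ∀ {v w} → h k (a v) ≡ β → Root f v w → ⌊ a w ≟ k ⌋ ≡ β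
      root-colour {v} {w} hv r = trans
        (sym (at-roots w λ aw∈E → no-roots (λ x → ∈-++⁺ʳ (map (_, k) vs) (∈-groups⁺ aw∈E x))
          (exhausted _ aw∈E) F refl (Root-fixed r)))
        (Root-invariant (λ x → h k (a x) ≡ β) preserved r hv)
        where
        preserved : ∀ u → lookup f u ≢ u → h k (a u) ≡ β → h k (a (lookup f u)) ≡ β
        preserved u ne hu with ∈-G⁻ vs (only F u ne)
        ... | inj₂ au∈E = trans (invariant (lookup f u) (a u) au∈E (c≢0 F u ne)) hu
        ... | inj₁ (fu∈ , au≡k) = trans (vs-inner β≡true _ fu∈) (sym β≡true)
          where
          β≡true : β ≡ true
          β≡true = trans (sym hu) (trans (cong (h k) au≡k) at-self)

      available-count : ∀ {v w} → h k (a v) ≡ β → Root f v w →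
        # (λ u → ⌊ available? f k w u ⌋) ≡ size k ∸ Σ[ (λ v → c v k) ∈ vs ] ∸ χ β
      available-count {v} {w} hv r = begin
        # (λ u → ⌊ available? f k w u ⌋)                   ≡⟨ sym (m+n∸n≡m _ (χ β)) ⟩
        # (λ u → ⌊ available? f k w u ⌋) + χ β ∸ χ β       ≡⟨ cong (_∸ χ β) roots ⟩
        # (λ u → ⌊ root? f k u ⌋) ∸ χ β
          ≡⟨ cong (_∸ χ β) (trans (sym (m+n∸n≡m _ Σvs)) (cong (_∸ Σvs)
               (roots-count k vs uvs G⊆vs (λ x x∈ → ∈-++⁺ˡ (∈-map⁺ (_, k) x∈)) F))) ⟩
        size k ∸ Σvs ∸ χ β ∎
        where
        Σvs : ℕ
        Σvs = Σ[ (λ v → c v k) ∈ vs ]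
        G⊆vs : ∀ x → (x , k) ∈ G vs → x ∈ vs
        G⊆vs x g∈ with ∈-G⁻ vs g∈
        ... | inj₁ (x∈ , _) = x∈
        ... | inj₂ k∈E = ⊥-elim (new k∈E)
        split : ∀ u → χ ⌊ available? f k w u ⌋ + (if ⌊ u Fin.≟ w ⌋ then χ β else 0) ≡ χ ⌊ root? f k u ⌋
        split u with u Fin.≟ w
        ... | yes refl = trans (cong (λ b → χ b + χ β)
                  (⌊⌋-false (root? f k u ×-dec no λ u≢u → u≢u refl) λ (_ , u≢u) → u≢u refl))
                (cong χ (trans (sym (root-colour hv r))
                  (⌊⌋-cong (a u ≟ k) (root? f k u) (Root-fixed r ,_) proj₂)))
        ... | no u≢w = trans (+-identityʳ _) (cong χ
                (⌊⌋-cong (root? f k u ×-dec yes u≢w) (root? f k u) proj₁ (_, u≢w)))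
        roots : # (λ u → ⌊ available? f k w u ⌋) + χ β ≡ # (λ u → ⌊ root? f k u ⌋)
        roots = trans (cong (# (λ u → ⌊ available? f k w u ⌋) +_) (sym (trans
            (Sum.big-single (Unique.allFin⁺ n) (∈-allFin w) λ u _ → if-no Fin._≟_) (if-yes Fin._≟_ {w} refl))))
          (trans (sym (Sum.big-∙ _ _ (allFin n))) (Sum.big-cong (allFin n) split))

    phase-ratio : ∀ β {vs} ws {D M} → Unique (ws ++ vs) →
      (β ≡ true → ∀ v → v ∈ vs → h k (a v) ≡ true) → (∀ v → v ∈ ws → h k (a v) ≡ β) →
      HasRatio (PartialForest (G vs)) D M →
      HasRatio (PartialForest (G (ws ++ vs))) (D * Π[ (λ v → c v k !) ∈ ws ])
        (M * ((size k ∸ Σ[ (λ v → c v k) ∈ vs ] ∸ χ β) P′ Σ[ (λ v → c v k) ∈ ws ]))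
    phase-ratio β [] _ _ _ R = HasRatio-≡ (sym (*-identityʳ _)) (sym (*-identityʳ _)) R
    phase-ratio β {vs} (w ∷ ws) {D} {M} (w∉ ∷ u) vs-inner ws-β R = HasRatio-≡
      (trans (*-assoc D _ _) (cong (D *_) (*-comm _ (c w k !))))
      (trans (*-assoc M _ _) (cong (M *_) (begin
        (Y P′ S) * (X P′ c w k)         ≡⟨ cong (λ z → (Y P′ S) * (z P′ c w k)) X≡ ⟩
        (Y P′ S) * ((Y ∸ S) P′ c w k)   ≡⟨ sym (P′-+ Y S (c w k)) ⟩
        Y P′ (S + c w k)                ≡⟨ cong (Y P′_) (+-comm S (c w k)) ⟩
        Y P′ (c w k + S)                ∎)))
      (AddGroup.add-group-ratio w k (G (ws ++ vs)) w∉G X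
        (λ f F x r → available-count β u inner′ F (ws-β w (here refl)) r)
        (phase-ratio β ws u vs-inner (λ v → ws-β v ∘ there) R))
      where
      S S₀ Y X : ℕ
      S  = Σ[ (λ v → c v k) ∈ ws ]
      S₀ = Σ[ (λ v → c v k) ∈ vs ]
      Y  = size k ∸ S₀ ∸ χ β
      X  = size k ∸ Σ[ (λ v → c v k) ∈ ws ++ vs ] ∸ χ β
      X≡ : X ≡ Y ∸ S
      X≡ = begin
        size k ∸ Σ[ (λ v → c v k) ∈ ws ++ vs ] ∸ χ β
          ≡⟨ cong (λ z → size k ∸ z ∸ χ β) (trans (Sum.big-++ _ ws vs) (+-comm S S₀)) ⟩
        size k ∸ (S₀ + S) ∸ χ β  ≡⟨ ∸-+-assoc (size k) (S₀ + S) (χ β) ⟩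
        size k ∸ (S₀ + S + χ β)  ≡⟨ cong (size k ∸_) (xy∙z≈xz∙y S₀ S (χ β)) ⟩
        size k ∸ (S₀ + χ β + S)  ≡⟨ sym (∸-+-assoc (size k) (S₀ + χ β) S) ⟩
        size k ∸ (S₀ + χ β) ∸ S  ≡⟨ cong (_∸ S) (sym (∸-+-assoc (size k) S₀ (χ β))) ⟩
        Y ∸ S                    ∎
      inner′ : β ≡ true → ∀ v → v ∈ ws ++ vs → h k (a v) ≡ true
      inner′ e v v∈ with ∈-++⁻ ws v∈
      ... | inj₁ v∈₁ = trans (ws-β v (there v∈₁)) e
      ... | inj₂ v∈₂ = vs-inner e v v∈₂
      w∉G : (w , k) ∉ G (ws ++ vs)
      w∉G g∈ with ∈-G⁻ (ws ++ vs) g∈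
      ... | inj₁ (w∈ , _) = ListAll.lookup w∉ w∈ refl
      ... | inj₂ k∈E = new k∈E

  own foreign weight : Colour → ℕ
  own k     = Σ[ (λ v → if h k (a v) then c v k else 0) ∈ allFin n ]
  foreign k = Σ[ (λ v → if h k (a v) then 0 else c v k) ∈ allFin n ]
  weight k  = ((size k ∸ 1) P′ own k) * ((size k ∸ own k) P′ foreign k)

  foreign+own : ∀ k → foreign k + own k ≡ demand k
  foreign+own k = Sum.big-split (λ v → h k (a v)) (λ v → c v k) (allFin n)

  colour-ratio : ∀ {k E D M} → Eliminable k E → HasRatio (PartialForest (groups E)) D M →
    HasRatio (PartialForest (groups (k ∷ E))) (Π[ (λ v → c v k !) ∈ allFin n ] * D) (weight k * M)
  colour-ratio {k} {E} {D} {M} elim R = HasRatio-≡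
    (trans (*-assoc D _ _) (trans (cong (D *_) (trans (*-comm _ Πouter) (trans (cong₂ _*_ Πouter≡ Πinner≡)
      (Prod.big-split (λ v → h k (a v)) (λ v → c v k !) (allFin n))))) (*-comm D _)))
    (trans (*-assoc M _ _) (trans (*-comm M _) (cong (_* M) (cong₂ _*_
      (cong ((size k ∸ 1) P′_) own≡) (cong₂ (λ x y → (size k ∸ x) P′ y) own≡ foreign≡)))))
    (phase-ratio elim false (outer k) (order-unique k) (λ ()) (λ _ → ∈-outer⁻)
      (subst (λ vs → HasRatio (PartialForest (map (_, k) vs ++ groups E)) (D * Πinner)
                 (M * ((size k ∸ 1) P′ Σ[ (λ v → c v k) ∈ inner k ])))
        (++-identityʳ (inner k))
        (phase-ratio elim true {[]} (inner k) (subst Unique (sym (++-identityʳ (inner k))) (inner-unique k))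
          (λ _ _ ()) (λ _ → ∈-inner⁻) R)))
    where
    Πinner Πouter : ℕ
    Πinner = Π[ (λ v → c v k !) ∈ inner k ]
    Πouter = Π[ (λ v → c v k !) ∈ outer k ]
    flip : ∀ {b} {x y : ℕ} → (if not b then x else y) ≡ (if b then y else x)
    flip {true}  = refl
    flip {false} = refl
    Πinner≡ : Πinner ≡ Π[ (λ v → if h k (a v) then c v k ! else 1) ∈ allFin n ]
    Πinner≡ = Prod.big-filter (λ v → h k (a v)) _ (allFin n)
    Πouter≡ : Πouter ≡ Π[ (λ v → if h k (a v) then 1 else c v k !) ∈ allFin n ]
    Πouter≡ = trans (Prod.big-filter (λ v → not (h k (a v))) _ (allFin n))
      (Prod.big-cong (allFin n) λ v → flip {h k (a v)})
    own≡ : Σ[ (λ v → c v k) ∈ inner k ] ≡ own k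
    own≡ = Sum.big-filter (λ v → h k (a v)) _ (allFin n)
    foreign≡ : Σ[ (λ v → c v k) ∈ outer k ] ≡ foreign k
    foreign≡ = trans (Sum.big-filter (λ v → not (h k (a v))) _ (allFin n))
      (Sum.big-cong (allFin n) λ v → flip {h k (a v)})

  data EliminationOrder : List Colour → Set where
    []  : EliminationOrder []
    _∷_ : ∀ {k E} → Eliminable k E → EliminationOrder E → EliminationOrder (k ∷ E)

  elimination-ratio : ∀ {E} → EliminationOrder E →
    HasRatio (PartialForest (groups E)) Π[ (λ k → Π[ (λ v → c v k !) ∈ allFin n ]) ∈ E ] Π[ weight ∈ E ]
  elimination-ratio []         = empty-ratio
  elimination-ratio (elim ∷ o) = colour-ratio elim (elimination-ratio o)

  weight-exhausted : ∀ {k} → demand k ≡ size k → size k ≢ 0 → weight k ≡ (size k ∸ 1) ! * foreign k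
  weight-exhausted {k} d≡s s≢0 with foreign k | own k | trans (foreign+own k) d≡s
  ... | zero | o | refl = trans (cong (_* ((o ∸ o) P′ 0)) (n<k⇒P′≡0 (pred-< o s≢0))) (sym (*-zeroʳ ((o ∸ 1) !)))
    where
    pred-< : ∀ o → o ≢ 0 → o ∸ 1 < o
    pred-< zero    o≢0 = ⊥-elim (o≢0 refl)
    pred-< (suc o) _   = ≤-refl
  ... | suc e | o | eq = begin
    ((size k ∸ 1) P′ o) * ((size k ∸ o) P′ suc e)
      ≡⟨ cong₂ (λ x y → (x P′ o) * (y P′ suc e)) (trans (cong (_∸ 1) (sym eq)) (+-comm e o))
           (trans (cong (_∸ o) (sym eq)) (m+n∸n≡m (suc e) o)) ⟩
    ((o + e) P′ o) * (suc e P′ suc e)      ≡⟨ cong (((o + e) P′ o) *_) (P′-suc e e) ⟩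
    ((o + e) P′ o) * (suc e * (e P′ e))    ≡⟨ lemma ((o + e) P′ o) (suc e) (e P′ e) ⟩
    ((o + e) P′ o) * (e P′ e) * suc e      ≡⟨ cong (λ z → ((o + e) P′ o) * (z P′ e) * suc e) (sym (m+n∸m≡n o e)) ⟩
    ((o + e) P′ o) * ((o + e ∸ o) P′ e) * suc e ≡⟨ cong (_* suc e) (sym (P′-+ (o + e) o e)) ⟩
    ((o + e) P′ (o + e)) * suc e           ≡⟨ cong (_* suc e) (P′-self (o + e)) ⟩
    (o + e) ! * suc e                      ≡⟨ cong (λ z → z ! * suc e) (trans (+-comm o e) (cong (_∸ 1) eq)) ⟩
    (size k ∸ 1) ! * suc e                 ∎
    where
    lemma : ∀ a b c → a * (b * c) ≡ a * c * b
    lemma = solve-∀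

  weight-root : ∀ {k} → suc (demand k) ≡ size k → foreign k ≡ 0 → weight k ≡ (size k ∸ 1) !
  weight-root {k} d≡s f≡0 rewrite f≡0 = trans (*-identityʳ _)
    (trans (cong ((size k ∸ 1) P′_) own≡) (P′-self (size k ∸ 1)))
    where
    own≡ : own k ≡ size k ∸ 1
    own≡ = trans (trans (cong (_+ own k) (sym f≡0)) (foreign+own k)) (cong (_∸ 1) d≡s)

-- Integer intervals, steps and boxes

open import Data.Integer using (+_; -[1+_]; ∣_∣; _-_; +≤+; -≤-; -≤+)

i-j+j≡i : ∀ i j → i - j ℤ.+ j ≡ i
i-j+j≡i = ℤ-Ring.solve-∀

i+j-j≡i : ∀ i j → i ℤ.+ j - j ≡ i
i+j-j≡i = ℤ-Ring.solve-∀

i+[j-i]≡j : ∀ i j → i ℤ.+ (j - i) ≡ j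
i+[j-i]≡j = ℤ-Ring.solve-∀

i+j-i≡j : ∀ i j → i ℤ.+ j - i ≡ j
i+j-i≡j = ℤ-Ring.solve-∀

i-[i-j]≡j : ∀ i j → i - (i - j) ≡ j
i-[i-j]≡j = ℤ-Ring.solve-∀

i-j≤k⇒i≤k+j : ∀ {i j k} → i - j ℤ.≤ k → i ℤ.≤ k ℤ.+ j
i-j≤k⇒i≤k+j {i} {j} {k} le = subst (ℤ._≤ k ℤ.+ j) (i-j+j≡i i j) (ℤ.+-monoˡ-≤ j le)

k≤i-j⇒k+j≤i : ∀ {i j k} → k ℤ.≤ i - j → k ℤ.+ j ℤ.≤ i
k≤i-j⇒k+j≤i {i} {j} {k} le = subst (k ℤ.+ j ℤ.≤_) (i-j+j≡i i j) (ℤ.+-monoˡ-≤ j le)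

∈-range⁺ : ∀ {a b x} → a ℤ.≤ x → x ℤ.≤ b → x ∈ range a b
∈-range⁺ {a} {b} {x} a≤x x≤b = subst (_∈ range a b) (trans (cong (ℤ._+_ a) ∣x-a∣) (i+[j-i]≡j a x))
  (∈-map⁺ (λ j → a ℤ.+ + j) (∈-upTo⁺ (below bound)))
  where
  ∣x-a∣ : + ∣ x - a ∣ ≡ x - a
  ∣x-a∣ = ℤ.0≤i⇒+∣i∣≡i (ℤ.i≤j⇒0≤j-i a≤x)
  bound : + suc ∣ x - a ∣ ℤ.≤ b - a ℤ.+ 1ℤ
  bound = subst (ℤ._≤ b - a ℤ.+ 1ℤ) (sym (trans (cong (ℤ._+_ 1ℤ) ∣x-a∣) (ℤ.+-comm 1ℤ (x - a))))
    (ℤ.+-monoˡ-≤ 1ℤ (ℤ.+-monoˡ-≤ (ℤ.- a) x≤b))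
  below : ∀ {j z} → + suc j ℤ.≤ z → j < clamp z
  below (+≤+ j<z) = j<z

∈-range⁻ : ∀ {a b x} → x ∈ range a b → a ℤ.≤ x × x ℤ.≤ b
∈-range⁻ {a} {b} x∈ with ∈-map⁻ (λ j → a ℤ.+ + j) x∈
... | (j , j∈ , refl) = ℤ.i≤i+j a (+ j) ,
  subst₂ ℤ._≤_ (lemma₁ a (+ j)) (lemma₂ a b) (ℤ.+-monoʳ-≤ (a - 1ℤ) (above _ (∈-upTo⁻ j∈)))
  where
  above : ∀ z → j < clamp z → + suc j ℤ.≤ z
  above (+ n) j<n = +≤+ j<n
  lemma₁ : ∀ a j → a - 1ℤ ℤ.+ (1ℤ ℤ.+ j) ≡ a ℤ.+ j
  lemma₁ = ℤ-Ring.solve-∀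
  lemma₂ : ∀ a b → a - 1ℤ ℤ.+ (b - a ℤ.+ 1ℤ) ≡ b
  lemma₂ = ℤ-Ring.solve-∀

range-unique : ∀ a b → Unique (range a b)
range-unique a b = Unique.map⁺ (λ e → ℤ.+-injective (∙-cancelˡ a _ _ e)) (Unique.upTo⁺ _)

module _ (m : ℤ) where

  sIdx-injective : ∀ {i j} → sIdx m i ≡ sIdx m j → i ≡ j
  sIdx-injective e = Fin.toℕ-injective (ℤ.+-injective (∙-cancelˡ m _ _ e))

  coef-sIdx : ∀ c j → coef m c (sIdx m j) ≡ lookup c j
  coef-sIdx c j = trans (Sum.big-single (Unique.allFin⁺ _) (∈-allFin j)
    λ i _ i≢j → if-no ℤ._≟_ (i≢j ∘ sIdx-injective)) (if-yes ℤ._≟_ {sIdx m j} refl)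

  coef≡0 : ∀ c s → (∀ j → s ≢ sIdx m j) → coef m c s ≡ 0
  coef≡0 c s s≢ = Sum.big-ε (allFin (width m)) λ j _ → if-no ℤ._≟_ (s≢ j ∘ sym)

  is-step? : ∀ s → Dec (∃ λ j → s ≡ sIdx m j)
  is-step? s = Fin.any? λ j → s ℤ.≟ sIdx m j

  coef≢0 : ∀ c s → coef m c s ≢ 0 → ∃ λ j → s ≡ sIdx m j
  coef≢0 c s ne with is-step? s
  ... | yes st = st
  ... | no ¬st = ⊥-elim (ne (coef≡0 c s λ j e → ¬st (j , e)))

  module _ (m≤1 : m ℤ.≤ 1ℤ) where

    private
      ∣1-m∣ : + ∣ 1ℤ - m ∣ ≡ 1ℤ - m
      ∣1-m∣ = ℤ.0≤i⇒+∣i∣≡i (ℤ.i≤j⇒0≤j-i m≤1)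

    sIdx-bounds : ∀ j → m ℤ.≤ sIdx m j × sIdx m j ℤ.≤ 1ℤ
    sIdx-bounds j = ℤ.i≤i+j m (+ toℕ j) ,
      subst (sIdx m j ℤ.≤_) (trans (cong (ℤ._+_ m) ∣1-m∣) (i+[j-i]≡j m 1ℤ))
        (ℤ.+-monoʳ-≤ m (+≤+ (s≤s⁻¹ (Fin.toℕ<n j))))

    sIdx-onto : ∀ {s} → m ℤ.≤ s → s ℤ.≤ 1ℤ → ∃ λ j → s ≡ sIdx m j
    sIdx-onto {s} m≤s s≤1 = fromℕ< bound ,
      sym (trans (cong (λ z → m ℤ.+ + z) (Fin.toℕ-fromℕ< bound)) (trans (cong (ℤ._+_ m) ∣s-m∣) (i+[j-i]≡j m s)))
      where
      ∣s-m∣ : + ∣ s - m ∣ ≡ s - m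
      ∣s-m∣ = ℤ.0≤i⇒+∣i∣≡i (ℤ.i≤j⇒0≤j-i m≤s)
      bound : ∣ s - m ∣ < width m
      bound = s≤s (ℤ.drop‿+≤+ (subst₂ ℤ._≤_ (sym ∣s-m∣) (sym ∣1-m∣) (ℤ.+-monoˡ-≤ (ℤ.- m) s≤1)))

∈-boxes⁺ : ∀ {k B} {c : Vec ℕ k} → All (ℕ._≤ B) c → c ∈ boxes k B
∈-boxes⁺ []                          = here refl
∈-boxes⁺ {suc k} {B} {x ∷ c} (x≤B ∷ c≤B) = ∈-concatMap⁺ (λ x → map (x ∷_) (boxes k B))
  (lose {P = λ y → x ∷ c ∈ map (y ∷_) (boxes k B)} (∈-upTo⁺ (s≤s x≤B)) (∈-map⁺ (x ∷_) (∈-boxes⁺ c≤B)))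

boxes-unique : ∀ k B → Unique (boxes k B)
boxes-unique zero    B = [] ∷ []
boxes-unique (suc k) B = go (upTo (suc B)) (Unique.upTo⁺ (suc B))
  where
  block : ℕ → List (Vec ℕ (suc k))
  block x = map (x ∷_) (boxes k B)
  go : ∀ xs → Unique xs → Unique (concatMap block xs)
  go []       _          = []
  go (x ∷ xs) (x∉ ∷ uxs) = Unique.++⁺ (Unique.map⁺ Vec.∷-injectiveʳ (boxes-unique k B)) (go xs uxs) disjoint
    where
    disjoint : ∀ {c} → ¬ (c ∈ block x × c ∈ concatMap block xs)
    disjoint {c} (c∈ , c∈′) with ∈-map⁻ (x ∷_) c∈ | find (∈-concatMap⁻ block {xs = xs} c∈′)
    ... | (_ , _ , refl) | (y , y∈ , c∈y) with ∈-map⁻ (y ∷_) c∈y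
    ...   | (_ , _ , e) = ListAll.lookup x∉ y∈ (Vec.∷-injectiveˡ e)

interval : ℕ → ℕ → List ℕ
interval s zero    = []
interval s (suc l) = s ∷ interval (suc s) l

∈-interval⁺ : ∀ {s l x} → s ℕ.≤ x → x < s + l → x ∈ interval s l
∈-interval⁺ {s} {zero}  s≤x x<s rewrite +-identityʳ s = ⊥-elim (<⇒≱ x<s s≤x)
∈-interval⁺ {s} {suc l} {x} s≤x x<s with s ℕ.≟ x
... | yes refl = here refl
... | no s≢x   = there (∈-interval⁺ (≤∧≢⇒< s≤x s≢x) (subst (x <_) (+-suc s l) x<s))

∈-interval⁻ : ∀ {s l x} → x ∈ interval s l → s ℕ.≤ x × x < s + l
∈-interval⁻ {s} {suc l} (here refl) = ≤-refl , m<m+n s ℕ.z<s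
∈-interval⁻ {s} {suc l} {x} (there x∈) with ∈-interval⁻ x∈
... | (s<x , x<) = <⇒≤ s<x , subst (x <_) (sym (+-suc s l)) x<

interval-unique : ∀ s l → Unique (interval s l)
interval-unique s zero    = []
interval-unique s (suc l) = ListAll.tabulate (λ x∈ s≡x → <⇒≢ (proj₁ (∈-interval⁻ x∈)) s≡x) ∷ interval-unique (suc s) l

iter-∘ : {A : Set} (f : A → A) → ∀ k l x → iter (k + l) f x ≡ iter k f (iter l f x)
iter-∘ f zero    l x = refl
iter-∘ f (suc k) l x = cong f (iter-∘ f k l x)

iter-fixed : {A : Set} {f : A → A} {x : A} → f x ≡ x → ∀ k → iter k f x ≡ x
iter-fixed e zero    = refl
iter-fixed {f = f} e (suc k) = trans (cong f (iter-fixed e k)) e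

iter-shift : {A : Set} (f : A → A) → ∀ k x → iter k f (f x) ≡ f (iter k f x)
iter-shift f zero    x = refl
iter-shift f (suc k) x = cong f (iter-shift f k x)

iter-Root : ∀ {n} (f : Vec (Fin n) n) k v → lookup f (iter k (lookup f) v) ≡ iter k (lookup f) v →
  Root f v (iter k (lookup f) v)
iter-Root f zero    v e = stop e
iter-Root f (suc k) v e = step (subst (Root f (lookup f v)) shift
  (iter-Root f k (lookup f v) (subst (λ z → lookup f z ≡ z) (sym shift) e)))
  where
  shift : iter k (lookup f) (lookup f v) ≡ lookup f (iter k (lookup f) v)
  shift = iter-shift (lookup f) k v

Root-iter : ∀ {n} (f : Vec (Fin n) n) {v w} → Root f v w → ∃ λ k → iter k (lookup f) v ≡ w
Root-iter f (stop _) = 0 , refl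
Root-iter f {v} (step r) with Root-iter f r
... | (k , e) = suc k , trans (sym (iter-shift (lookup f) k v)) e

iter-past : {A : Set} {f : A → A} {x w : A} {k l : ℕ} → f w ≡ w → k ℕ.≤ l → iter k f x ≡ w → iter l f x ≡ w
iter-past {f = f} {x} {k = k} {l} fw k≤l e = trans (cong (λ z → iter z f x) (sym (m∸n+n≡m k≤l)))
  (trans (iter-∘ f (l ℕ.∸ k) k x) (trans (cong (iter (l ℕ.∸ k) f) e) (iter-fixed fw (l ℕ.∸ k))))

-- By the pigeonhole principle the orbit of v repeats within n steps; since it ends in a
-- fixed point, the repeated vertex is that fixed point.
Root-within-n : ∀ {n} (f : Vec (Fin n) n) {v w} → Root f v w → iter n (lookup f) v ≡ w
Root-within-n {n} f {v} {w} r with Root-iter f r | Fin.pigeonhole (n<1+n n) (λ i → iter (toℕ i) (lookup f) v)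
... | (k , e) | (i , j , i<j , eq) = iter-past (Root-fixed r) (s≤s⁻¹ (Fin.toℕ<n i))
  (trans (sym (periods k)) (trans (sym (iter-∘ g (k ℕ.* p) (toℕ i) v))
    (iter-past (Root-fixed r) (≤-trans k≤kp (m≤m+n (k ℕ.* p) (toℕ i))) e)))
  where
  g : Fin n → Fin n
  g = lookup f
  p : ℕ
  p = toℕ j ℕ.∸ toℕ i
  period : iter p g (iter (toℕ i) g v) ≡ iter (toℕ i) g v
  period = trans (sym (iter-∘ g p (toℕ i) v)) (trans (cong (λ z → iter z g v) (m∸n+n≡m (<⇒≤ i<j))) (sym eq))
  periods : ∀ q → iter (q ℕ.* p) g (iter (toℕ i) g v) ≡ iter (toℕ i) g v
  periods zero    = refl
  periods (suc q) = trans (iter-∘ g p (q ℕ.* p) _) (trans (cong (iter p g) (periods q)) period)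
  k≤kp : k ℕ.≤ k ℕ.* p
  k≤kp = m≤m*n k p {{ℕ.>-nonZero (m<n⇒0<n∸m i<j)}}

#≡1-unique : ∀ {n} {p : Fin n → Bool} → # p ≡ 1 → ∀ {x y} → p x ≡ true → p y ≡ true → x ≡ y
#≡1-unique {n} {p} #p≡1 {x} {y} px py with y Fin.≟ x
... | yes e = sym e
... | no y≢x = ⊥-elim (1+n≢0 (trans (sym (trans (if-no Fin._≟_ y≢x) (cong χ py)))
    (Σ-0⇒0 (allFin n) rest≡0 (∈-allFin y))))
  where
  rest≡0 : Σ[ (λ u → if ⌊ u Fin.≟ x ⌋ then 0 else χ (p u)) ∈ allFin n ] ≡ 0
  rest≡0 = +-cancelʳ-≡ 1 _ 0 (trans (cong (_+_ _) (sym (trans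
      (Sum.big-single (Unique.allFin⁺ n) (∈-allFin x) λ u _ → if-no Fin._≟_)
      (trans (if-yes Fin._≟_ {x} refl) (cong χ px)))))
    (trans (Sum.big-split (λ u → ⌊ u Fin.≟ x ⌋) (χ ∘ p) (allFin n)) #p≡1))

all-∧ : {A : Set} (g : List A → Bool) (p : A → Bool) → g [] ≡ true → (∀ x xs → g (x ∷ xs) ≡ (p x ∧ g xs)) →
  ∀ xs → g xs ≡ all p xs
all-∧ g p g[] g∷ []       = g[]
all-∧ g p g[] g∷ (x ∷ xs) = trans (g∷ x xs) (cong (p x ∧_) (all-∧ g p g[] g∷ xs))

hasInType≡ : ∀ m {n} (t : TreeData n) v i d → hasInType m t v i d ≡
  ((lookup (proj₂ (proj₂ t)) v ==ℤ i) ∧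
    all (λ j → childrenAt t v (sIdx m j) ==ℕ lookup d j) (allFin (width m)))
hasInType≡ m {n} t v i d = unfold (all-∧ _ p refl (λ _ _ → refl))
  where
  p : Fin (width m) → Bool
  p j = childrenAt t v (sIdx m j) ==ℕ lookup d j
  -- The hole stands for the local function of hasInType, which has no name here.
  unfold : (∀ js → _ ≡ all p js) → hasInType m t v i d ≡
    ((lookup (proj₂ (proj₂ t)) v ==ℤ i) ∧ all p (allFin (width m)))
  unfold tail with List.tabulate {A = Fin (width m)} {n = ∣ 1ℤ - m ∣} Fin.suc
  ... | js = cong (λ b → (lookup (proj₂ (proj₂ t)) v ==ℤ i) ∧ (p zero ∧ b)) (tail js)

-- Trees with a given profile

-- When abscissa k is eliminated, the abscissas beyond it (seen from 0) are already exhausted,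
-- and their vertices lie in components whose roots are at k.
reaches : ℤ → ℤ → Bool
reaches (+ 0)     x = true
reaches (+ suc k) x = ⌊ + suc k ℤ.≤? x ⌋
reaches -[1+ k ]  x = ⌊ x ℤ.≤? -[1+ k ] ⌋

minus-injective : ∀ k {i j} → k - i ≡ k - j → i ≡ j
minus-injective k {i} {j} e = trans (sym (i-[i-j]≡j k i)) (trans (cong (k -_) e) (i-[i-j]≡j k j))

module Profile (m : ℤ) (m≤1 : m ℤ.≤ 1ℤ) (ℓ r : ℤ) (B : ℕ) (N : ℤ → Vec ℕ (width m) → ℕ)
  (support : (i : ℤ) (c : Vec ℕ (width m)) → N i c ≢ 0 → (ℓ ℤ.≤ i) × (i ℤ.≤ r) × All (ℕ._≤ B) c)
  (positive : (i : ℤ) → ℓ ℤ.≤ i → i ℤ.≤ r → 0 < Quant.nI m ℓ r B N i)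
  (compatible : (i : ℤ) → χ (i ==ℤ 0ℤ) + Σ[ (λ j → Quant.nIS m ℓ r B N i (sIdx m j)) ∈ allFin (width m) ]
    ≡ Quant.nI m ℓ r B N i)
  (unit-or-nonnegative : m ≡ -1ℤ ⊎ ((i : ℤ) (c : Vec ℕ (width m)) → i ℤ.< 0ℤ → N i c ≡ 0))
  where

  open Quant m ℓ r B N

  InRange : ℤ → Set
  InRange i = ℓ ℤ.≤ i × i ℤ.≤ r

  inRange? : ∀ i → Dec (InRange i)
  inRange? i = (ℓ ℤ.≤? i) ×-dec (i ℤ.≤? r)

  N-outside : ∀ {i} → ¬ InRange i → ∀ c → N i c ≡ 0
  N-outside {i} ¬in c with N i c ℕ.≟ 0
  ... | yes e = e
  ... | no ne = let (ℓ≤i , i≤r , _) = support i c ne in ⊥-elim (¬in (ℓ≤i , i≤r))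

  nI-outside : ∀ {i} → ¬ InRange i → nI i ≡ 0
  nI-outside ¬in = Sum.big-ε Cs λ c _ → N-outside ¬in c

  nI≢0 : ∀ {i} → InRange i → nI i ≢ 0
  nI≢0 (ℓ≤i , i≤r) = m<n⇒n≢0 (positive _ ℓ≤i i≤r)

  0-inRange : InRange 0ℤ
  0-inRange with inRange? 0ℤ
  ... | yes in₀ = in₀
  ... | no ¬in = ⊥-elim (1+n≢0 (trans (compatible 0ℤ) (nI-outside ¬in)))

  negative⇒m≡-1 : ∀ {i} → ℓ ℤ.≤ i → i ℤ.< 0ℤ → m ≡ -1ℤ
  negative⇒m≡-1 {i} ℓ≤i i<0 = [ id , (λ N≡0 → ⊥-elim
    (nI≢0 (ℓ≤i , ℤ.≤-trans (ℤ.<⇒≤ i<0) (proj₂ 0-inRange)) (Sum.big-ε Cs λ c _ → N≡0 i c i<0))) ]′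
    unit-or-nonnegative

  negatives positives abscissas : List ℤ
  negatives = map -[1+_] (interval 0 ∣ ℓ ∣)
  positives = map (λ x → + suc x) (interval 0 ∣ r ∣)
  abscissas = 0ℤ ∷ negatives ++ positives

  ∈-positives⁺ : ∀ {x} → + suc x ℤ.≤ r → + suc x ∈ positives
  ∈-positives⁺ (+≤+ x<r) = ∈-map⁺ _ (∈-interval⁺ z≤n x<r)

  ∈-negatives⁺ : ∀ {x} → ℓ ℤ.≤ -[1+ x ] → -[1+ x ] ∈ negatives
  ∈-negatives⁺ (-≤- x≤l) = ∈-map⁺ _ (∈-interval⁺ z≤n (s≤s x≤l))

  ∈-positives⁻ : ∀ {k} → k ∈ positives → 1ℤ ℤ.≤ k × k ℤ.≤ r
  ∈-positives⁻ k∈ with ∈-map⁻ _ k∈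
  ... | (x , x∈ , refl) = +≤+ (s≤s z≤n) ,
    subst (+ suc x ℤ.≤_) (ℤ.0≤i⇒+∣i∣≡i (proj₂ 0-inRange)) (+≤+ (proj₂ (∈-interval⁻ x∈)))

  ∈-negatives⁻ : ∀ {k} → k ∈ negatives → ℓ ℤ.≤ k × k ℤ.≤ -1ℤ
  ∈-negatives⁻ k∈ with ∈-map⁻ _ k∈
  ... | (x , x∈ , refl) = below ℓ (proj₁ 0-inRange) (proj₂ (∈-interval⁻ x∈)) , -≤- z≤n
    where
    below : ∀ l → l ℤ.≤ 0ℤ → x < ∣ l ∣ → l ℤ.≤ -[1+ x ]
    below -[1+ l ] _ x<l = -≤- (s≤s⁻¹ x<l)
    below (+ zero) _ ()
    below (+ suc _) (+≤+ ()) _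

  ∈-abscissas⁺ : ∀ {k} → InRange k → k ∈ abscissas
  ∈-abscissas⁺ {+ zero}   _         = here refl
  ∈-abscissas⁺ {+ suc _}  (_ , k≤r) = there (∈-++⁺ʳ negatives (∈-positives⁺ k≤r))
  ∈-abscissas⁺ { -[1+ _ ]} (ℓ≤k , _) = there (∈-++⁺ˡ (∈-negatives⁺ ℓ≤k))

  ∈-abscissas⁻ : ∀ {k} → k ∈ abscissas → InRange k
  ∈-abscissas⁻ (here refl) = 0-inRange
  ∈-abscissas⁻ (there k∈) with ∈-++⁻ negatives k∈
  ... | inj₁ k∈₁ = let (ℓ≤k , k≤-1) = ∈-negatives⁻ k∈₁ in
    ℓ≤k , ℤ.≤-trans k≤-1 (ℤ.≤-trans -≤+ (proj₂ 0-inRange))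
  ... | inj₂ k∈₂ = let (1≤k , k≤r) = ∈-positives⁻ k∈₂ in
    ℤ.≤-trans (proj₁ 0-inRange) (ℤ.≤-trans (+≤+ z≤n) 1≤k) , k≤r

  positives-unique : Unique positives
  positives-unique = Unique.map⁺ (suc-injective ∘ ℤ.+-injective) (interval-unique 0 _)

  negatives-unique : Unique negatives
  negatives-unique = Unique.map⁺ ℤ.-[1+-injective (interval-unique 0 _)

  abscissas-unique : Unique abscissas
  abscissas-unique = ListAll.tabulate nonzero ∷ Unique.++⁺ negatives-unique positives-unique disjoint
    where
    disjoint : ∀ {k} → ¬ (k ∈ negatives × k ∈ positives)
    disjoint (k∈ , k∈′) with ℤ.≤-trans (proj₁ (∈-positives⁻ k∈′)) (proj₂ (∈-negatives⁻ k∈))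
    ... | ()
    nonzero : ∀ {k} → k ∈ negatives ++ positives → 0ℤ ≢ k
    nonzero k∈ refl with ∈-++⁻ negatives k∈
    ... | inj₁ 0∈ with proj₂ (∈-negatives⁻ 0∈)
    ...   | ()
    nonzero k∈ refl | inj₂ 0∈ with proj₁ (∈-positives⁻ 0∈)
    ...   | +≤+ ()

  InType : Set
  InType = ℤ × Vec ℕ (width m)

  _≟ᵗ_ : DecidableEquality InType
  _≟ᵗ_ = Product.≡-dec ℤ._≟_ (Vec.≡-dec ℕ._≟_)

  types : List InType
  types = cartesianProduct (range ℓ r) Cs

  types-unique : Unique types
  types-unique = Unique.cartesianProduct⁺ (range-unique ℓ r) (boxes-unique (width m) B)

  ∈-types : ∀ t → uncurry N t ≢ 0 → t ∈ types
  ∈-types (i , c) ne = let (ℓ≤i , i≤r , c≤B) = support i c ne in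
    ∈-cartesianProduct⁺ (∈-range⁺ ℓ≤i i≤r) (∈-boxes⁺ c≤B)

  open Words _≟ᵗ_ types types-unique public

  Σ-range-single : (g : ℤ → ℕ) (k : ℤ) → (∀ i → i ≢ k → g i ≡ 0) → (¬ InRange k → g k ≡ 0) →
    Σ[ g ∈ range ℓ r ] ≡ g k
  Σ-range-single g k off out with inRange? k
  ... | yes (ℓ≤k , k≤r) = Sum.big-single (range-unique ℓ r) (∈-range⁺ ℓ≤k k≤r) λ i _ → off i
  ... | no ¬in = trans (Sum.big-ε (range ℓ r) λ i i∈ → off i λ { refl → ¬in (∈-range⁻ i∈) }) (sym (out ¬in))

  abscissa : ∀ {n} → Vec InType n → Fin n → ℤ
  abscissa τ v = proj₁ (lookup τ v)

  capacity : ∀ {n} → Vec InType n → Fin n → ℤ → ℕ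
  capacity τ v k = coef m (proj₂ (lookup τ v)) (k - abscissa τ v)

  module Typed {n : ℕ} (τ : Vec InType n) (content : HasContent (uncurry N) τ) where

    a : Fin n → ℤ
    a = abscissa τ

    c : Fin n → ℤ → ℕ
    c = capacity τ

    open Elimination ℤ._≟_ a c reaches public

    Σ-types : (φ : InType → ℕ) → Σ[ (λ v → φ (lookup τ v)) ∈ allFin n ] ≡
      Σ[ (λ i → Σ[ (λ d → φ (i , d) * N i d) ∈ Cs ]) ∈ range ℓ r ]
    Σ-types φ = trans (Σ-letters ∈-types τ content φ) (Sum.big-cartesianProduct _ (range ℓ r) Cs)

    supported : ∀ v → ℓ ℤ.≤ a v × a v ℤ.≤ r × All (ℕ._≤ B) (proj₂ (lookup τ v))
    supported v = support _ _ (letter-occurs ∈-types τ content v)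

    a-inRange : ∀ v → InRange (a v)
    a-inRange v = let (ℓ≤ , ≤r , _) = supported v in ℓ≤ , ≤r

    size≡nI : ∀ k → size k ≡ nI k
    size≡nI k = begin
      size k
        ≡⟨ Σ-types (λ (i , _) → χ ⌊ i ℤ.≟ k ⌋) ⟩
      Σ[ (λ i → Σ[ (λ d → χ ⌊ i ℤ.≟ k ⌋ * N i d) ∈ Cs ]) ∈ range ℓ r ]
        ≡⟨ Σ-range-single _ k
             (λ i i≢k → Sum.big-ε Cs λ d _ → cong (λ b → χ b * N i d) (⌊⌋-false (i ℤ.≟ k) i≢k))
             (λ ¬in → trans g≡ (nI-outside ¬in)) ⟩
      Σ[ (λ d → χ ⌊ k ℤ.≟ k ⌋ * N k d) ∈ Cs ]
        ≡⟨ g≡ ⟩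
      nI k ∎
      where
      g≡ : Σ[ (λ d → χ ⌊ k ℤ.≟ k ⌋ * N k d) ∈ Cs ] ≡ nI k
      g≡ = Sum.big-cong Cs λ d →
        trans (cong (λ b → χ b * N k d) (⌊⌋-true (k ℤ.≟ k) refl)) (*-identityˡ (N k d))

    demand≡ : ∀ k → demand k ≡ Σ[ (λ j → nIS k (sIdx m j)) ∈ allFin (width m) ]
    demand≡ k = begin
      demand k
        ≡⟨ Σ-types (λ (i , d) → coef m d (k - i)) ⟩
      Σ[ (λ i → Σ[ (λ d → coef m d (k - i) * N i d) ∈ Cs ]) ∈ range ℓ r ]
        ≡⟨ Sum.big-cong (range ℓ r) (λ i → Sum.big-cong Cs λ d →
             cong (λ z → coef m d (k - i) * N z d) (sym (i-[i-j]≡j k i))) ⟩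
      Σ[ (λ i → nIS k (k - i)) ∈ range ℓ r ]
        ≡⟨ sym (Sum.big-map (nIS k) (k -_) (range ℓ r)) ⟩
      Σ[ nIS k ∈ map (k -_) (range ℓ r) ]
        ≡⟨ Sum.big-same-support ℤ._≟_ (nIS k) _ _
             (Unique.map⁺ (minus-injective k) (range-unique ℓ r))
             (Unique.map⁺ (sIdx-injective m) (Unique.allFin⁺ (width m))) steps range-steps ⟩
      Σ[ nIS k ∈ map (sIdx m) (allFin (width m)) ]
        ≡⟨ Sum.big-map (nIS k) (sIdx m) (allFin (width m)) ⟩
      Σ[ (λ j → nIS k (sIdx m j)) ∈ allFin (width m) ] ∎
      where
      steps : ∀ s → s ∈ map (k -_) (range ℓ r) → s ∈ map (sIdx m) (allFin (width m)) ⊎ nIS k s ≡ 0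
      steps s _ with is-step? m s
      ... | yes (j , refl) = inj₁ (∈-map⁺ (sIdx m) (∈-allFin j))
      ... | no ¬st = inj₂ (Sum.big-ε Cs λ d _ → cong (_* N (k - s) d) (coef≡0 m d s λ j e → ¬st (j , e)))
      range-steps : ∀ s → s ∈ map (sIdx m) (allFin (width m)) → s ∈ map (k -_) (range ℓ r) ⊎ nIS k s ≡ 0
      range-steps s _ with inRange? (k - s)
      ... | yes (ℓ≤ , ≤r) = inj₁ (subst (_∈ map (k -_) (range ℓ r)) (i-[i-j]≡j k s) (∈-map⁺ (k -_) (∈-range⁺ ℓ≤ ≤r)))
      ... | no ¬in = inj₂ (Sum.big-ε Cs λ d _ → trans (cong (coef m d s *_) (N-outside ¬in d)) (*-zeroʳ (coef m d s)))

    χ+demand≡size : ∀ k → χ (k ==ℤ 0ℤ) + demand k ≡ size k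
    χ+demand≡size k = trans (cong (_+_ (χ (k ==ℤ 0ℤ))) (demand≡ k)) (trans (compatible k) (sym (size≡nI k)))

    demand≡size : ∀ {k} → k ≢ 0ℤ → demand k ≡ size k
    demand≡size {k} k≢0 = trans (cong (λ b → χ b + demand k) (sym (⌊⌋-false (k ℤ.≟ 0ℤ) k≢0))) (χ+demand≡size k)

    c-outside : ∀ {k} → ¬ InRange k → ∀ v → c v k ≡ 0
    c-outside {k} ¬in v = Σ-0⇒0 (allFin n)
      (m+n≡0⇒n≡0 (χ (k ==ℤ 0ℤ)) (trans (χ+demand≡size k) (trans (size≡nI k) (nI-outside ¬in)))) (∈-allFin v)

    c-step : ∀ {v k} → c v k ≢ 0 → m ℤ.≤ k - a v × k - a v ℤ.≤ 1ℤ
    c-step {v} {k} ne with coef≢0 m (proj₂ (lookup τ v)) (k - a v) ne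
    ... | (j , e) = let (lo , hi) = sIdx-bounds m m≤1 j in subst (m ℤ.≤_) (sym e) lo , subst (ℤ._≤ 1ℤ) (sym e) hi

    c≢0⇒≤suc : ∀ {v k} → c v k ≢ 0 → k ℤ.≤ ℤ.suc (a v)
    c≢0⇒≤suc {v} {k} ne = i-j≤k⇒i≤k+j {j = a v} (proj₂ (c-step {v} {k} ne))

    c≢0⇒pred≤ : ∀ {v k} → m ≡ -1ℤ → c v k ≢ 0 → ℤ.pred (a v) ℤ.≤ k
    c≢0⇒pred≤ {v} {k} refl ne = k≤i-j⇒k+j≤i {j = a v} (proj₁ (c-step {v} {k} ne))

    top-order : ∀ l s → s + l ≡ ∣ r ∣ → EliminationOrder (map (λ x → + suc x) (interval s l))
    top-order zero    s _  = []
    top-order (suc l) s eq = record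
      { new       = λ k∈ → let (_ , s<x , e) = above k∈ in <-irrefl (suc-injective (ℤ.+-injective e)) s<x
      ; exhausted = λ e e∈ → demand≡size λ { refl → nonzero (above e∈) }
      ; invariant = λ v e e∈ ne → let (x , s<x , e≡) = above e∈ in trans
          (⌊⌋-true (+ suc s ℤ.≤? a v) (pred-≤
            (ℤ.≤-trans (+≤+ (s≤s s<x)) (ℤ.≤-trans (ℤ.≤-reflexive (sym e≡)) (c≢0⇒≤suc ne)))))
          (sym (⌊⌋-true (+ suc s ℤ.≤? e) (subst (+ suc s ℤ.≤_) (sym e≡) (+≤+ (s≤s (<⇒≤ s<x))))))
      ; at-roots  = at-roots
      ; at-self   = ⌊⌋-true (+ suc s ℤ.≤? + suc s) ℤ.≤-refl
      } ∷ top-order l (suc s) (trans (sym (+-suc s l)) eq)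
      where
      E : List ℤ
      E = map (λ x → + suc x) (interval (suc s) l)
      above : ∀ {k} → k ∈ E → ∃ λ x → s < x × k ≡ + suc x
      above k∈ with ∈-map⁻ _ k∈
      ... | (x , x∈ , e) = x , proj₁ (∈-interval⁻ x∈) , e
      nonzero : ¬ (∃ λ x → s < x × 0ℤ ≡ + suc x)
      nonzero (_ , _ , ())
      pred-≤ : ∀ {y} → + suc (suc s) ℤ.≤ ℤ.suc y → + suc s ℤ.≤ y
      pred-≤ {+ y} (+≤+ le) = +≤+ (s≤s⁻¹ le)
      pred-≤ { -[1+ zero ]} (+≤+ ())
      pred-≤ { -[1+ suc y ]} ()
      at-roots : ∀ u → a u ∉ E → ⌊ + suc s ℤ.≤? a u ⌋ ≡ ⌊ a u ℤ.≟ + suc s ⌋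
      at-roots u au∉ = ⌊⌋-cong (+ suc s ℤ.≤? a u) (a u ℤ.≟ + suc s) (squeeze (proj₂ (a-inRange u)) au∉)
        λ { e → ℤ.≤-reflexive (sym e) }
        where
        squeeze : ∀ {x} → x ℤ.≤ r → x ∉ E → + suc s ℤ.≤ x → x ≡ + suc s
        squeeze {+ suc x} (+≤+ x<r) x∉ (+≤+ s≤x) with s ℕ.≟ x
        ... | yes refl = refl
        ... | no s≢x = ⊥-elim (x∉ (∈-map⁺ _ (∈-interval⁺ (≤∧≢⇒< (s≤s⁻¹ s≤x) s≢x)
                         (subst (x <_) (trans (sym eq) (+-suc s l)) x<r))))

    bottom-order : ∀ l s → s + l ≡ ∣ ℓ ∣ → EliminationOrder (map -[1+_] (interval s l) ++ positives)
    bottom-order zero    s _  = top-order ∣ r ∣ 0 refl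
    bottom-order (suc l) s eq = record
      { new       = new
      ; exhausted = λ e e∈ → demand≡size λ { refl → nonzero e∈ }
      ; invariant = invariant
      ; at-roots  = at-roots
      ; at-self   = ⌊⌋-true (-[1+ s ] ℤ.≤? -[1+ s ]) ℤ.≤-refl
      } ∷ bottom-order l (suc s) (trans (sym (+-suc s l)) eq)
      where
      Eₙ : List ℤ
      Eₙ = map -[1+_] (interval (suc s) l)
      s<∣ℓ∣ : s < ∣ ℓ ∣
      s<∣ℓ∣ = subst (s <_) eq (m<m+n s ℕ.z<s)
      m≡-1 : m ≡ -1ℤ
      m≡-1 = negative⇒m≡-1 (proj₁ (∈-negatives⁻ (∈-map⁺ -[1+_] (∈-interval⁺ z≤n s<∣ℓ∣)))) ℤ.-<+
      below : ∀ {k} → k ∈ Eₙ → ∃ λ x → s < x × k ≡ -[1+ x ]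
      below k∈ with ∈-map⁻ _ k∈
      ... | (x , x∈ , e) = x , proj₁ (∈-interval⁻ x∈) , e
      new : -[1+ s ] ∉ Eₙ ++ positives
      new k∈ with ∈-++⁻ Eₙ k∈
      ... | inj₁ k∈₁ = let (_ , s<x , e) = below k∈₁ in <-irrefl (ℤ.-[1+-injective e) s<x
      ... | inj₂ k∈₂ with proj₁ (∈-positives⁻ k∈₂)
      ...   | ()
      nonzero : 0ℤ ∉ Eₙ ++ positives
      nonzero k∈ with ∈-++⁻ Eₙ k∈
      ... | inj₁ k∈₁ with below k∈₁
      ...   | (_ , _ , ())
      nonzero k∈ | inj₂ k∈₂ with proj₁ (∈-positives⁻ k∈₂)
      ...   | +≤+ ()
      pred-≤⁻ : ∀ {x y} → s < x → ℤ.pred y ℤ.≤ -[1+ x ] → y ℤ.≤ -[1+ s ]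
      pred-≤⁻ {y = + zero}  s<x (-≤- x≤0) = ⊥-elim (n≮0 (<-≤-trans s<x x≤0))
      pred-≤⁻ {y = + suc y} s<x ()
      pred-≤⁻ {y = -[1+ y ]} s<x (-≤- x≤y) = -≤- (s≤s⁻¹ (≤-trans s<x x≤y))
      nonneg : ∀ {k y} → 1ℤ ℤ.≤ k → k ℤ.≤ ℤ.suc y → ¬ (y ℤ.≤ -[1+ s ])
      nonneg {y = -[1+ zero ]} 1≤k k≤ _ with ℤ.≤-trans 1≤k k≤
      ... | +≤+ ()
      nonneg {y = -[1+ suc y ]} 1≤k k≤ _ with ℤ.≤-trans 1≤k k≤
      ... | ()
      invariant : ∀ v e → e ∈ Eₙ ++ positives → c v e ≢ 0 → ⌊ a v ℤ.≤? -[1+ s ] ⌋ ≡ ⌊ e ℤ.≤? -[1+ s ] ⌋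
      invariant v e e∈ ne with ∈-++⁻ Eₙ e∈
      ... | inj₁ e∈₁ with below e∈₁
      ...   | (x , s<x , refl) = trans (⌊⌋-true (a v ℤ.≤? -[1+ s ]) (pred-≤⁻ s<x (c≢0⇒pred≤ m≡-1 ne)))
                                   (sym (⌊⌋-true (-[1+ x ] ℤ.≤? -[1+ s ]) (-≤- (<⇒≤ s<x))))
      invariant v e e∈ ne | inj₂ e∈₂ =
        let 1≤e = proj₁ (∈-positives⁻ e∈₂) in
        trans (⌊⌋-false (a v ℤ.≤? -[1+ s ]) (nonneg 1≤e (c≢0⇒≤suc ne)))
          (sym (⌊⌋-false (e ℤ.≤? -[1+ s ]) λ e≤ → contra (ℤ.≤-trans 1≤e e≤)))
        where
        contra : ¬ (1ℤ ℤ.≤ -[1+ s ])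
        contra ()
      at-roots : ∀ u → a u ∉ Eₙ ++ positives → ⌊ a u ℤ.≤? -[1+ s ] ⌋ ≡ ⌊ a u ℤ.≟ -[1+ s ] ⌋
      at-roots u au∉ = ⌊⌋-cong (a u ℤ.≤? -[1+ s ]) (a u ℤ.≟ -[1+ s ])
        (squeeze (proj₁ (a-inRange u)) (au∉ ∘ ∈-++⁺ˡ)) ℤ.≤-reflexive
        where
        squeeze : ∀ {x} → ℓ ℤ.≤ x → x ∉ Eₙ → x ℤ.≤ -[1+ s ] → x ≡ -[1+ s ]
        squeeze { -[1+ x ]} (-≤- x≤l) x∉ (-≤- s≤x) with s ℕ.≟ x
        ... | yes refl = refl
        ... | no s≢x = ⊥-elim (x∉ (∈-map⁺ _ (∈-interval⁺ (≤∧≢⇒< s≤x s≢x)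
                         (subst (x <_) (trans (sym eq) (+-suc s l)) (s≤s x≤l)))))

    elimination-order : EliminationOrder abscissas
    elimination-order = record
      { new       = λ 0∈ → let (0∉ , _) = split abscissas-unique in ListAll.lookup 0∉ 0∈ refl
      ; exhausted = λ e e∈ → demand≡size λ { refl → let (0∉ , _) = split abscissas-unique in ListAll.lookup 0∉ e∈ refl }
      ; invariant = λ _ _ _ _ → refl
      ; at-roots  = λ u au∉ → sym (⌊⌋-true (a u ℤ.≟ 0ℤ) (at-zero au∉ (∈-abscissas⁺ (a-inRange u))))
      ; at-self   = refl
      } ∷ bottom-order ∣ ℓ ∣ 0 refl
      where
      split : ∀ {x xs} → Unique (x ∷ xs) → ListAll.All (λ y → x ≢ y) xs × Unique xs
      split (x∉ ∷ u) = x∉ , u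
      at-zero : ∀ {x} → x ∉ negatives ++ positives → x ∈ abscissas → x ≡ 0ℤ
      at-zero _  (here e)   = e
      at-zero x∉ (there x∈) = ⊥-elim (x∉ x∈)

    vertex-factorials : ∀ v → Π[ (λ k → c v k !) ∈ abscissas ] ≡
      Π[ (λ j → lookup (proj₂ (lookup τ v)) j !) ∈ allFin (width m) ]
    vertex-factorials v = begin
      Π[ (λ k → φ (k - a v)) ∈ abscissas ]
        ≡⟨ sym (Prod.big-map φ (_- a v) abscissas) ⟩
      Π[ φ ∈ map (_- a v) abscissas ]
        ≡⟨ Prod.big-same-support ℤ._≟_ φ _ _
             (Unique.map⁺ (λ {i} {j} e → trans (sym (i-j+j≡i i (a v)))
               (trans (cong (ℤ._+ a v) e) (i-j+j≡i j (a v)))) abscissas-unique)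
             (Unique.map⁺ (sIdx-injective m) (Unique.allFin⁺ (width m))) steps abscissa-steps ⟩
      Π[ φ ∈ map (sIdx m) (allFin (width m)) ]
        ≡⟨ Prod.big-map φ (sIdx m) (allFin (width m)) ⟩
      Π[ (λ j → φ (sIdx m j)) ∈ allFin (width m) ]
        ≡⟨ Prod.big-cong (allFin (width m)) (λ j → cong _! (coef-sIdx m (proj₂ (lookup τ v)) j)) ⟩
      Π[ (λ j → lookup (proj₂ (lookup τ v)) j !) ∈ allFin (width m) ] ∎
      where
      φ : ℤ → ℕ
      φ s = coef m (proj₂ (lookup τ v)) s !
      steps : ∀ s → s ∈ map (_- a v) abscissas → s ∈ map (sIdx m) (allFin (width m)) ⊎ φ s ≡ 1
      steps s _ with is-step? m s
      ... | yes (j , refl) = inj₁ (∈-map⁺ (sIdx m) (∈-allFin j))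
      ... | no ¬st = inj₂ (cong _! (coef≡0 m (proj₂ (lookup τ v)) s λ j e → ¬st (j , e)))
      abscissa-steps : ∀ s → s ∈ map (sIdx m) (allFin (width m)) → s ∈ map (_- a v) abscissas ⊎ φ s ≡ 1
      abscissa-steps s _ with inRange? (s ℤ.+ a v)
      ... | yes in-s = inj₁ (subst (_∈ map (_- a v) abscissas) (i+j-j≡i s (a v)) (∈-map⁺ (_- a v) (∈-abscissas⁺ in-s)))
      ... | no ¬in = inj₂ (cong _! (subst (λ z → coef m (proj₂ (lookup τ v)) z ≡ 0) (i+j-j≡i s (a v)) (c-outside ¬in v)))

    all-factorials : Π[ (λ k → Π[ (λ v → c v k !) ∈ allFin n ]) ∈ abscissas ] ≡
      Π[ (λ j → Π[ (λ b → (b !) ^ nSB j b) ∈ upTo (suc B) ]) ∈ allFin (width m) ]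
    all-factorials = begin
      Π[ (λ k → Π[ (λ v → c v k !) ∈ allFin n ]) ∈ abscissas ]
        ≡⟨ Prod.big-swap (λ k v → c v k !) abscissas (allFin n) ⟩
      Π[ (λ v → Π[ (λ k → c v k !) ∈ abscissas ]) ∈ allFin n ]
        ≡⟨ Prod.big-cong (allFin n) vertex-factorials ⟩
      Π[ (λ v → Π[ (λ j → degree j v !) ∈ allFin (width m) ]) ∈ allFin n ]
        ≡⟨ Prod.big-swap (λ v j → degree j v !) (allFin n) (allFin (width m)) ⟩
      Π[ (λ j → Π[ (λ v → degree j v !) ∈ allFin n ]) ∈ allFin (width m) ]
        ≡⟨ Prod.big-cong (allFin (width m)) by-degree ⟩
      Π[ (λ j → Π[ (λ b → (b !) ^ nSB j b) ∈ upTo (suc B) ]) ∈ allFin (width m) ] ∎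
      where
      degree : Fin (width m) → Fin n → ℕ
      degree j v = lookup (proj₂ (lookup τ v)) j
      if-* : ∀ b x → χ b * x ≡ (if b then x else 0)
      if-* true  x = *-identityˡ x
      if-* false x = refl
      nSB≡ : ∀ j b → # (λ v → degree j v ==ℕ b) ≡ nSB j b
      nSB≡ j b = trans (Σ-types (λ (_ , d) → χ (lookup d j ==ℕ b)))
        (Sum.big-cong (range ℓ r) λ i → Sum.big-cong Cs λ d → if-* (lookup d j ==ℕ b) (N i d))
      by-degree : ∀ j → Π[ (λ v → degree j v !) ∈ allFin n ] ≡ Π[ (λ b → (b !) ^ nSB j b) ∈ upTo (suc B) ]
      by-degree j = begin
        Π[ (λ v → degree j v !) ∈ allFin n ]
          ≡⟨ sym (Prod.big-by-key ℕ._≟_ (degree j) _ (allFin n) (upTo (suc B)) (Unique.upTo⁺ (suc B)) λ v _ →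
               inj₁ (∈-upTo⁺ (s≤s (VecAll.lookup⁺ (proj₂ (proj₂ (supported v))) j)))) ⟩
        Π[ (λ b → Π[ (λ v → if degree j v ==ℕ b then degree j v ! else 1) ∈ allFin n ]) ∈ upTo (suc B) ]
          ≡⟨ Prod.big-cong (upTo (suc B)) (λ b → trans (Prod.big-cong (allFin n) (value b))
               (trans (Π-if-^ (λ v → degree j v ==ℕ b) (b !) (allFin n)) (cong ((b !) ^_) (nSB≡ j b)))) ⟩
        Π[ (λ b → (b !) ^ nSB j b) ∈ upTo (suc B) ] ∎
        where
        value : ∀ b v → (if degree j v ==ℕ b then degree j v ! else 1) ≡ (if degree j v ==ℕ b then b ! else 1)
        value b v with degree j v ℕ.≟ b
        ... | yes refl = refl
        ... | no _     = refl

    foreign≡nIS : ∀ k s → reaches k (k - s) ≡ false →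
      (∀ i → i ≢ k - s → reaches k i ≡ true ⊎ (∀ d → coef m d (k - i) ≡ 0)) → foreign k ≡ nIS k s
    foreign≡nIS k s outer-s off = begin
      foreign k
        ≡⟨ Σ-types φ ⟩
      Σ[ (λ i → Σ[ (λ d → φ (i , d) * N i d) ∈ Cs ]) ∈ range ℓ r ]
        ≡⟨ Σ-range-single _ (k - s) (λ i i≢ → Sum.big-ε Cs λ d _ → cong (_* N i d) (φ≡0 i i≢ d))
             (λ ¬in → Sum.big-ε Cs λ d _ → trans (cong (φ (k - s , d) *_) (N-outside ¬in d)) (*-zeroʳ (φ (k - s , d)))) ⟩
      Σ[ (λ d → φ (k - s , d) * N (k - s) d) ∈ Cs ]
        ≡⟨ Sum.big-cong Cs (λ d → cong (_* N (k - s) d)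
             (trans (cong (if_then 0 else coef m d (k - (k - s))) outer-s) (cong (coef m d) (i-[i-j]≡j k s)))) ⟩
      nIS k s ∎
      where
      φ : InType → ℕ
      φ (i , d) = if reaches k i then 0 else coef m d (k - i)
      φ≡0 : ∀ i → i ≢ k - s → ∀ d → φ (i , d) ≡ 0
      φ≡0 i i≢ d with reaches k i | off i i≢
      ... | true  | _           = refl
      ... | false | inj₂ coef≡0 = coef≡0 d

    foreign-positive : ∀ {k} → k ∈ positives → foreign k ≡ nIS k 1ℤ
    foreign-positive k∈ with ∈-map⁻ _ k∈
    ... | (x , _ , refl) = foreign≡nIS (+ suc x) 1ℤ
      (⌊⌋-false (+ suc x ℤ.≤? + x) λ { (+≤+ x<x) → 1+n≰n x<x }) off
      where
      off : ∀ i → i ≢ + x → reaches (+ suc x) i ≡ true ⊎ (∀ d → coef m d (+ suc x - i) ≡ 0)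
      off i i≢x with + suc x ℤ.≤? i
      ... | yes _ = inj₁ refl
      ... | no x≮i = inj₂ λ d → coef≡0 m d (+ suc x - i) λ j e → i≢x (∙-cancelˡ 1ℤ i (+ x)
              (ℤ.≤-antisym (ℤ.i<j⇒suc[i]≤j (ℤ.≰⇒> x≮i))
                (i-j≤k⇒i≤k+j {j = i} (subst (ℤ._≤ 1ℤ) (sym e) (proj₂ (sIdx-bounds m m≤1 j))))))

    foreign-negative : ∀ {k} → k ∈ negatives → foreign k ≡ nIS k -1ℤ
    foreign-negative {k} k∈ = by-sign k (negative⇒m≡-1 (proj₁ (∈-negatives⁻ k∈))
        (ℤ.≤-<-trans (proj₂ (∈-negatives⁻ k∈)) ℤ.-<+)) (proj₂ (∈-negatives⁻ k∈))
      where
      lemma : ∀ k → k - -1ℤ ≡ 1ℤ ℤ.+ k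
      lemma = ℤ-Ring.solve-∀
      lemma′ : ∀ i → 1ℤ ℤ.+ (-1ℤ ℤ.+ i) ≡ i
      lemma′ = ℤ-Ring.solve-∀
      by-sign : ∀ k → m ≡ -1ℤ → k ℤ.≤ -1ℤ → foreign k ≡ nIS k -1ℤ
      by-sign k@(-[1+ x ]) m≡-1 _ = foreign≡nIS k -1ℤ
        (⌊⌋-false (k - -1ℤ ℤ.≤? k) λ le → ℤ.<⇒≱ (ℤ.suc[i]≤j⇒i<j (ℤ.≤-reflexive (sym (lemma k)))) le) off
        where
        off : ∀ i → i ≢ k - -1ℤ → reaches k i ≡ true ⊎ (∀ d → coef m d (k - i) ≡ 0)
        off i i≢ with i ℤ.≤? k
        ... | yes _ = inj₁ refl
        ... | no i≰k = inj₂ λ d → coef≡0 m d (k - i) λ j e → i≢ (trans (ℤ.≤-antisym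
                (subst (ℤ._≤ ℤ.suc k) (lemma′ i) (ℤ.+-monoʳ-≤ 1ℤ (k≤i-j⇒k+j≤i {i = k} {j = i}
                  (subst₂ ℤ._≤_ m≡-1 (sym e) (proj₁ (sIdx-bounds m m≤1 j))))))
                (ℤ.i<j⇒suc[i]≤j (ℤ.≰⇒> i≰k))) (sym (lemma k)))

    weights : Π[ weight ∈ abscissas ] ≡ Π[ (λ i → (nI i ∸ 1) !) ∈ range ℓ r ]
      * Π[ (λ i → nIS i -1ℤ) ∈ range ℓ -1ℤ ] * Π[ (λ i → nIS i 1ℤ) ∈ range 1ℤ r ]
    weights = begin
      weight 0ℤ * Π[ weight ∈ negatives ++ positives ]
        ≡⟨ cong₂ _*_ weight-0 (trans (Prod.big-++ weight negatives positives)
             (cong₂ _*_ (part negatives -1ℤ negative≢0 foreign-negative (there ∘ ∈-++⁺ˡ))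
               (part positives 1ℤ positive≢0 foreign-positive (there ∘ ∈-++⁺ʳ negatives)))) ⟩
      F 0ℤ * ((Π[ F ∈ negatives ] * X) * (Π[ F ∈ positives ] * Y))
        ≡⟨ lemma (F 0ℤ) Π[ F ∈ negatives ] X Π[ F ∈ positives ] Y ⟩
      F 0ℤ * (Π[ F ∈ negatives ] * Π[ F ∈ positives ]) * X * Y
        ≡⟨ cong (λ z → F 0ℤ * z * X * Y) (sym (Prod.big-++ F negatives positives)) ⟩
      Π[ F ∈ abscissas ] * X * Y
        ≡⟨ cong₂ _*_ (cong₂ _*_
             (same F abscissas-unique (λ _ k∈ → ∈-abscissas⁻ k∈) (λ _ → ∈-abscissas⁺))
             (same (λ i → nIS i -1ℤ) negatives-unique (λ _ → ∈-negatives⁻) negatives-onto))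
             (same (λ i → nIS i 1ℤ) positives-unique (λ _ → ∈-positives⁻) positives-onto) ⟩
      Π[ F ∈ range ℓ r ] * Π[ (λ i → nIS i -1ℤ) ∈ range ℓ -1ℤ ] * Π[ (λ i → nIS i 1ℤ) ∈ range 1ℤ r ] ∎
      where
      F : ℤ → ℕ
      F i = (nI i ∸ 1) !
      X Y : ℕ
      X = Π[ (λ i → nIS i -1ℤ) ∈ negatives ]
      Y = Π[ (λ i → nIS i 1ℤ) ∈ positives ]
      lemma : ∀ f p x q y → f * ((p * x) * (q * y)) ≡ f * (p * q) * x * y
      lemma = solve-∀
      weight-0 : weight 0ℤ ≡ F 0ℤ
      weight-0 = trans (weight-root (χ+demand≡size 0ℤ) (Sum.big-ε (allFin n) λ _ _ → refl))
        (cong (λ z → (z ∸ 1) !) (size≡nI 0ℤ))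
      negative≢0 : 0ℤ ∉ negatives
      negative≢0 0∈ with proj₂ (∈-negatives⁻ 0∈)
      ... | ()
      positive≢0 : 0ℤ ∉ positives
      positive≢0 0∈ with proj₁ (∈-positives⁻ 0∈)
      ... | +≤+ ()
      part : ∀ ks s → 0ℤ ∉ ks → (∀ {k} → k ∈ ks → foreign k ≡ nIS k s) →
        (∀ {k} → k ∈ ks → k ∈ abscissas) →
        Π[ weight ∈ ks ] ≡ Π[ F ∈ ks ] * Π[ (λ i → nIS i s) ∈ ks ]
      part ks s 0∉ foreign≡ ks⊆ = trans (Prod.big-cong-∈ ks λ k k∈ →
          trans (weight-exhausted (demand≡size λ { refl → 0∉ k∈ })
                  (λ e → nI≢0 (∈-abscissas⁻ (ks⊆ k∈)) (trans (sym (size≡nI k)) e)))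
            (cong₂ (λ x y → (x ∸ 1) ! * y) (size≡nI k) (foreign≡ k∈)))
        (Prod.big-∙ F _ ks)
      same : ∀ (g : ℤ → ℕ) {ks lo hi} → Unique ks → (∀ k → k ∈ ks → lo ℤ.≤ k × k ℤ.≤ hi) →
        (∀ k → lo ℤ.≤ k × k ℤ.≤ hi → k ∈ ks) → Π[ g ∈ ks ] ≡ Π[ g ∈ range lo hi ]
      same g {ks} {lo} {hi} uks in-bounds onto = Prod.big-same-support ℤ._≟_ g ks (range lo hi) uks (range-unique lo hi)
        (λ k k∈ → let (lo≤k , k≤hi) = in-bounds k k∈ in inj₁ (∈-range⁺ lo≤k k≤hi))
        (λ k k∈ → inj₁ (onto k (∈-range⁻ k∈)))
      negatives-onto : ∀ k → ℓ ℤ.≤ k × k ℤ.≤ -1ℤ → k ∈ negatives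
      negatives-onto -[1+ _ ] (ℓ≤k , _) = ∈-negatives⁺ ℓ≤k
      positives-onto : ∀ k → 1ℤ ℤ.≤ k × k ℤ.≤ r → k ∈ positives
      positives-onto (+ suc _) (_ , k≤r) = ∈-positives⁺ k≤r
      positives-onto (+ zero) (+≤+ () , _)

    parents-ratio : HasRatio (PartialForest (groups abscissas))
      Π[ (λ j → Π[ (λ b → (b !) ^ nSB j b) ∈ upTo (suc B) ]) ∈ allFin (width m) ]
      (Π[ (λ i → (nI i ∸ 1) !) ∈ range ℓ r ] * Π[ (λ i → nIS i -1ℤ) ∈ range ℓ -1ℤ ] * Π[ (λ i → nIS i 1ℤ) ∈ range 1ℤ r ])
    parents-ratio = HasRatio-≡ all-factorials weights (elimination-ratio elimination-order)

  inType : ∀ {n} → TreeData n → Fin n → InType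
  inType t v = lookup (proj₂ (proj₂ t)) v , tabulate (λ j → childrenAt t v (sIdx m j))

  hasInType≡inType : ∀ {n} (t : TreeData n) v i d → hasInType m t v i d ≡ ⌊ inType t v ≟ᵗ (i , d) ⌋
  hasInType≡inType t v i d = trans (hasInType≡ m t v i d) (∧-ext (⌊⌋-true⁻¹ (x ℤ.≟ i)) (λ e → ⌊⌋-true (x ℤ.≟ i) e))
    where
    x : ℤ
    x = lookup (proj₂ (proj₂ t)) v
    p : Fin (width m) → Bool
    p j = childrenAt t v (sIdx m j) ==ℕ lookup d j
    ∧-true : ∀ {b b′} → b ∧ b′ ≡ true → b ≡ true × b′ ≡ true
    ∧-true {true} {true} _ = refl , refl
    all⁻ : ∀ {js} → all p js ≡ true → ∀ {j} → j ∈ js → p j ≡ true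
    all⁻ {_ ∷ _} e (here refl) = proj₁ (∧-true e)
    all⁻ {_ ∷ _} e (there j∈)  = all⁻ (proj₂ (∧-true e)) j∈
    all⁺ : ∀ js → (∀ j → p j ≡ true) → all p js ≡ true
    all⁺ []       _ = refl
    all⁺ (j ∷ js) e = cong₂ _∧_ (e j) (all⁺ js e)
    ∧-ext : ∀ {b} → (b ≡ true → x ≡ i) → (x ≡ i → b ≡ true) →
      (b ∧ all p (allFin (width m))) ≡ ⌊ inType t v ≟ᵗ (i , d) ⌋
    ∧-ext {b} to from with inType t v ≟ᵗ (i , d)
    ... | yes refl = cong₂ _∧_ (from refl) (all⁺ (allFin (width m)) λ j →
            ⌊⌋-true (childrenAt t v (sIdx m j) ℕ.≟ lookup d j) (sym (lookup∘tabulate (λ j → childrenAt t v (sIdx m j)) j)))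
    ... | no ne with bool (b ∧ all p (allFin (width m)))
    ...   | inj₂ e = e
    ...   | inj₁ e = ⊥-elim (ne (cong₂ _,_ (to (proj₁ (∧-true e))) (lookup-ext λ j →
            trans (lookup∘tabulate (λ j → childrenAt t v (sIdx m j)) j)
              (⌊⌋-true⁻¹ (childrenAt t v (sIdx m j) ℕ.≟ lookup d j)
                (all⁻ {allFin (width m)} (proj₂ (∧-true {b} e)) (∈-allFin j))))))

  inTypeCount≡ : ∀ {n} (t : TreeData n) i d → inTypeCount m t i d ≡ # (λ v → ⌊ inType t v ≟ᵗ (i , d) ⌋)
  inTypeCount≡ {n} t i d = trans (length-filter-χ (λ v → hasInType m t v i d) (allFin n))
    (#-cong λ v → hasInType≡inType t v i d)

  module _ {n : ℕ} (τ : Vec InType n) (content : HasContent (uncurry N) τ) where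

    open Typed τ content

    childrenAt≡children : ∀ ρ f as → (∀ u → lookup as u ≡ a u) → lookup f ρ ≡ ρ → (∀ u → lookup f u ≡ u → u ≡ ρ) →
      ∀ v s → childrenAt (ρ , f , as) v s ≡ children f v (a v ℤ.+ s)
    childrenAt≡children ρ f as as≡a ρ-root only-ρ v s =
      trans (length-filter-χ _ (allFin n)) (#-cong pointwise)
      where
      pointwise : ∀ u → (not (u ==F ρ) ∧ (lookup f u ==F v) ∧ (lookup as u ==ℤ (lookup as v ℤ.+ s)))
        ≡ ⌊ child? f v (a v ℤ.+ s) u ⌋
      pointwise u rewrite as≡a u | as≡a v
        with u Fin.≟ ρ | lookup f u Fin.≟ u | lookup f u Fin.≟ v | a u ℤ.≟ a v ℤ.+ s
      ... | yes _    | yes _    | _     | _     = refl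
      ... | yes refl | no fu≢u  | _     | _     = ⊥-elim (fu≢u ρ-root)
      ... | no u≢ρ   | yes fu≡u | _     | _     = ⊥-elim (u≢ρ (only-ρ u fu≡u))
      ... | no _     | no _     | yes _ | yes _ = refl
      ... | no _     | no _     | yes _ | no _  = refl
      ... | no _     | no _     | no _  | _     = refl

    module _ {f : Vec (Fin n) n} (F : PartialForest (groups abscissas) f) where

      open PartialForest F

      children≡c : ∀ v k → children f v k ≡ c v k
      children≡c v k with inRange? k
      ... | yes in-k = full (∈-groups⁺ (∈-abscissas⁺ in-k) v)
      ... | no ¬in = trans (#-empty λ u → ⌊⌋-false (child? f v k u) λ { (_ , _ , refl) → ¬in (a-inRange u) })
                       (sym (c-outside ¬in v))

      root-at-0 : ∀ {u} → lookup f u ≡ u → a u ≡ 0ℤ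
      root-at-0 {u} fu≡u with a u ℤ.≟ 0ℤ
      ... | yes e = e
      ... | no ne = ⊥-elim (no-roots (∈-groups⁺ (∈-abscissas⁺ (a-inRange u))) (demand≡size ne) F refl fu≡u)

      root-unique : ∀ {u w} → lookup f u ≡ u → lookup f w ≡ w → u ≡ w
      root-unique {u} {w} fu≡u fw≡w = #≡1-unique {p = λ x → ⌊ root? f 0ℤ x ⌋} one
        (⌊⌋-true (root? f 0ℤ u) (fu≡u , root-at-0 fu≡u)) (⌊⌋-true (root? f 0ℤ w) (fw≡w , root-at-0 fw≡w))
        where
        one : # (λ x → ⌊ root? f 0ℤ x ⌋) ≡ 1
        one = +-cancelʳ-≡ (demand 0ℤ) _ 1 (trans
          (roots-count 0ℤ (allFin n) (Unique.allFin⁺ n) (λ v _ → ∈-allFin v)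
            (λ v _ → ∈-groups⁺ {E = abscissas} (here refl) v) F)
          (sym (χ+demand≡size 0ℤ)))

      module _ (v₀ : Fin n) where

        private
          ρ : Fin n
          ρ = iter n (lookup f) v₀
          t : TreeData n
          t = ρ , f , Vec.map proj₁ τ
          ρ-root : lookup f ρ ≡ ρ
          ρ-root = let (_ , path) = forest v₀ in
            subst (λ z → lookup f z ≡ z) (sym (Root-within-n f path)) (Root-fixed path)
          map-a : ∀ u → lookup (Vec.map proj₁ τ) u ≡ a u
          map-a u = Vec.lookup-map u proj₁ τ

        tree-inType : ∀ v → inType t v ≡ lookup τ v
        tree-inType v = cong₂ _,_ (map-a v) (lookup-ext λ j → begin
          lookup (tabulate λ j → childrenAt t v (sIdx m j)) j
            ≡⟨ lookup∘tabulate (λ j → childrenAt t v (sIdx m j)) j ⟩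
          childrenAt t v (sIdx m j)
            ≡⟨ childrenAt≡children ρ f (Vec.map proj₁ τ) map-a ρ-root
                 (λ u fu≡u → root-unique fu≡u ρ-root) v (sIdx m j) ⟩
          children f v (a v ℤ.+ sIdx m j)
            ≡⟨ children≡c v _ ⟩
          coef m (proj₂ (lookup τ v)) (a v ℤ.+ sIdx m j - a v)
            ≡⟨ cong (coef m (proj₂ (lookup τ v))) (i+j-i≡j (a v) (sIdx m j)) ⟩
          coef m (proj₂ (lookup τ v)) (sIdx m j)
            ≡⟨ coef-sIdx m (proj₂ (lookup τ v)) j ⟩
          lookup (proj₂ (lookup τ v)) j ∎)

        embedded-tree : IsEmbeddedTree m t
        embedded-tree = ρ-root , reach , trans (map-a ρ) (root-at-0 ρ-root) , steps
          where
          reach : ∀ v → iter n (lookup f) v ≡ ρ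
          reach v = let (_ , path) = forest v in
            trans (Root-within-n f path) (root-unique (Root-fixed path) ρ-root)
          steps : ∀ v → (v ≡ ρ → ⊥) → m ≤ lookup (Vec.map proj₁ τ) v - lookup (Vec.map proj₁ τ) (lookup f v)
            × lookup (Vec.map proj₁ τ) v - lookup (Vec.map proj₁ τ) (lookup f v) ≤ 1ℤ
          steps v v≢ρ rewrite map-a v | map-a (lookup f v) =
            c-step {lookup f v} {a v} (c≢0 v (λ fv≡v → v≢ρ (root-unique fv≡v ρ-root)))

  HasProfile : ∀ {n} → TreeData n → Set
  HasProfile t = IsEmbeddedTree m t × ((i : ℤ) (d : Vec ℕ (width m)) → inTypeCount m t i d ≡ N i d)

  TypedForest : ∀ {n} → Vec InType n × Vec (Fin n) n → Set
  TypedForest (τ , f) = HasContent (uncurry N) τ × E.PartialForest (E.groups abscissas) f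
    where module E = Elimination ℤ._≟_ (abscissa τ) (capacity τ) reaches

  toTree : ∀ {n} → Fin n → Vec InType n × Vec (Fin n) n → TreeData n
  toTree {n} v₀ (τ , f) = iter n (lookup f) v₀ , f , Vec.map proj₁ τ

  toTree-into : ∀ {n} (v₀ : Fin n) x → TypedForest x → HasProfile (toTree v₀ x)
  toTree-into v₀ (τ , f) (content , F) = embedded-tree τ content F v₀ , λ i d →
    trans (inTypeCount≡ (toTree v₀ (τ , f)) i d)
      (trans (#-cong λ v → cong (λ z → ⌊ z ≟ᵗ (i , d) ⌋) (tree-inType τ content F v₀ v)) (content (i , d)))

  toTree-injective : ∀ {n} (v₀ : Fin n) x y → TypedForest x → TypedForest y → toTree v₀ x ≡ toTree v₀ y → x ≡ y
  toTree-injective v₀ (τ , f) (τ′ , f′) (content , F) (content′ , F′) eq = cong₂ _,_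
    (lookup-ext λ v → trans (sym (tree-inType τ content F v₀ v))
      (trans (cong (λ t → inType t v) eq) (tree-inType τ′ content′ F′ v₀ v)))
    (cong (proj₁ ∘ proj₂) eq)

  toTree-onto : ∀ {n} (v₀ : Fin n) t → HasProfile t →
    Σ (Vec InType n × Vec (Fin n) n) λ x → TypedForest x × toTree v₀ x ≡ t
  toTree-onto {n} v₀ t@(ρ , f , as) ((ρ-root , reach , _ , tree-steps) , counts) =
    (τ , f) , (content , record
      { forest = λ v → _ , iter-Root f n v (subst (λ z → lookup f z ≡ z) (sym (reach v)) ρ-root)
      ; only   = λ u _ → ∈-groups⁺ (∈-abscissas⁺ (a-inRange u)) (lookup f u)
      ; full   = λ {v} {k} _ → children≡ v k }) ,
    cong₂ _,_ (reach v₀) (cong (f ,_) (lookup-ext λ v →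
      trans (Vec.lookup-map v proj₁ τ) (cong proj₁ (lookup∘tabulate (inType t) v))))
    where
    τ : Vec InType n
    τ = tabulate (inType t)
    content : HasContent (uncurry N) τ
    content (i , d) = trans (#-cong λ v → cong (λ z → ⌊ z ≟ᵗ (i , d) ⌋) (lookup∘tabulate (inType t) v))
      (trans (sym (inTypeCount≡ t i d)) (counts i d))
    open Typed τ content
    as≡a : ∀ u → lookup as u ≡ a u
    as≡a u = sym (cong proj₁ (lookup∘tabulate (inType t) u))
    only-ρ : ∀ u → lookup f u ≡ u → u ≡ ρ
    only-ρ u fu≡u = trans (sym (iter-fixed fu≡u n)) (reach u)
    children≡ : ∀ v k → children f v k ≡ c v k
    children≡ v k with is-step? m (k - a v)
    ... | yes (j , e) = begin
      children f v k
        ≡⟨ cong (children f v) (trans (sym (i+[j-i]≡j (a v) k)) (cong (ℤ._+_ (a v)) e)) ⟩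
      children f v (a v ℤ.+ sIdx m j)
        ≡⟨ sym (childrenAt≡children τ content ρ f as as≡a ρ-root only-ρ v (sIdx m j)) ⟩
      childrenAt t v (sIdx m j)
        ≡⟨ sym (trans (cong (λ z → lookup (proj₂ z) j) (lookup∘tabulate (inType t) v))
             (lookup∘tabulate (λ j → childrenAt t v (sIdx m j)) j)) ⟩
      lookup (proj₂ (lookup τ v)) j
        ≡⟨ sym (coef-sIdx m (proj₂ (lookup τ v)) j) ⟩
      coef m (proj₂ (lookup τ v)) (sIdx m j)
        ≡⟨ cong (coef m (proj₂ (lookup τ v))) (sym e) ⟩
      c v k ∎
    ... | no ¬st = trans (#-empty λ u → ⌊⌋-false (child? f v k u) (not-child u))
                     (sym (coef≡0 m (proj₂ (lookup τ v)) (k - a v) λ j e → ¬st (j , e)))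
      where
      not-child : ∀ u → ¬ (lookup f u ≢ u × lookup f u ≡ v × a u ≡ k)
      not-child u (fu≢u , refl , refl) with tree-steps u (λ { refl → fu≢u ρ-root })
      ... | (lo , hi) rewrite as≡a u | as≡a (lookup f u) = ¬st (sIdx-onto m m≤1 lo hi)

  total≢0 : total ≢ 0
  total≢0 e = nI≢0 0-inRange (Σ-0⇒0 (range ℓ r) e (uncurry ∈-range⁺ 0-inRange))

  profile-ratio : HasRatio (HasProfile {total}) denominator numerator
  profile-ratio = HasRatio-≡
    (cong (_* Π[ (λ j → Π[ (λ b → (b !) ^ nSB j b) ∈ upTo (suc B) ]) ∈ allFin (width m) ])
      (Prod.big-cartesianProduct (λ (i , d) → N i d !) (range ℓ r) Cs))
    (trans (sym (*-assoc (total !) _ _)) (cong (_* Π[ (λ i → nIS i 1ℤ) ∈ range 1ℤ r ]) (sym (*-assoc (total !) _ _))))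
    (HasRatio-bijection (toTree v₀) (toTree-into v₀) (toTree-injective v₀) (toTree-onto v₀) typed-forests-ratio)
    where
    v₀ : Fin total
    v₀ = fromℕ< (n≢0⇒n>0 total≢0)
    typed-forests-ratio : HasRatio (TypedForest {total}) _ _
    typed-forests-ratio = HasRatio-Σ
      (words-ratio total (uncurry N) ∈-types (Sum.big-cartesianProduct (uncurry N) (range ℓ r) Cs))
      (λ τ content → Typed.parents-ratio τ content)

theorem2p5 : (m : ℤ) → m ≤ 1ℤ →
  (ℓ r : ℤ) (B : ℕ) (N : ℤ → Vec ℕ (width m) → ℕ) →
  -- n(i,c) is supported in [ℓ, r] × {0..B}^(2-m)
  ((i : ℤ) (c : Vec ℕ (width m)) → N i c ≢ 0 →
    (ℓ ≤ i) × (i ≤ r) × All (Data.Nat._≤ B) c) →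
  ℓ ≤ r →
  -- n_i > 0 for ℓ ≤ i ≤ r (so ℓ, r are the smallest/largest i with n_i > 0)
  ((i : ℤ) → ℓ ≤ i → i ≤ r → 0 < Quant.nI m ℓ r B N i) →
  -- compatibility condition (see NOTES.md: imposed for all i)
  ((i : ℤ) → χ (i ==ℤ 0ℤ) + Σ[ (λ j → Quant.nIS m ℓ r B N i (sIdx m j)) ∈ allFin (width m) ]
               ≡ Quant.nI m ℓ r B N i) →
  (m ≡ -1ℤ ⊎ ((i : ℤ) (c : Vec ℕ (width m)) → i <ℤ 0ℤ → N i c ≡ 0)) →
  Σ ℕ λ K →
    HasCount (λ (t : TreeData (Quant.total m ℓ r B N)) →
                IsEmbeddedTree m t
                × ((i : ℤ) (c : Vec ℕ (width m)) → inTypeCount m t i c ≡ N i c))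
             K
    × (K * Quant.denominator m ℓ r B N ≡ Quant.numerator m ℓ r B N)
theorem2p5 m m≤1 ℓ r B N support _ positive compatible unit-or-nonnegative =
  Profile.profile-ratio m m≤1 ℓ r B N support positive compatible unit-or-nonnegative
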